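{- Assuming the Orthogonal Vectors Conjecture, for any $\epsilon>0$ there is no data structure that, given any straight-line grammar (SLG) $G$ representing a string $T\in\Sigma^{N}$, where $\Sigma=\{1,\ldots,\sigma\}$ and $\sigma=\Omega((N/\log N)^{1/2})$, answers range distinct counting queries on $T$ in $O(|G|^{1-\epsilon}\log^{O(1)}N)$ time, and takes $O(|G|^{2-\epsilon}\log^{O(1)}N)$ time to construct.
   Context: **Model and asymptotics.** Running times are in the standard word RAM model with machine words of $\Theta(\log n)$ bits ($n$ the input-size parameter), where standard arithmetic and bitwise operations take $O(1)$ time. $\log^{O(1)}N$ means $(\log N)^c$ for some constant $c$. The condition $\sigma=\Omega((N/\log N)^{1/2})$ restricts the inputs that must be handled to those with $\sigma\ge\kappa(N/\log N)^{1/2}$ for a fixed constant $\kappa>0$. **Orthogonal Vectors (OV).** Input: a set $A\subseteq\{0,1\}^d$ with $|A|=n$. Output: whether there exist $x,y\in A$ with $\langle x,y\rangle=\sum_{i=1}^d x[i]\,y[i]=0$. **Orthogonal Vectors Conjecture:** for every constant $\epsilon>0$ there exists a constant $c\ge1$ such that OV cannot be solved in $O(n^{2-\epsilon})$ time on instances with $d=c\log n$. **Straight-line grammars.** An SLG is a context-free grammar $G=(V,\Sigma,R,S)$ (nonterminals $V$, terminals $\Sigma$, $V\cap\Sigma=\emptyset$, rules $R\subseteq V\times(V\cup\Sigma)^*$, start symbol $S\in V$) such that each $N\in V$ has exactly one rule $(N,\gamma)\in R$, whose right-hand side $\gamma$ is denoted $\mathrm{rhs}_G(N)$, and there is an ordering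 $N_1,\ldots,N_{|V|}$ of $V$ with $\mathrm{rhs}_G(N_i)\in(\{N_{i+1},\ldots,N_{|V|}\}\cup\Sigma)^*$ for all $i$. Hence $G$ generates (represents) exactly one string. The size of $G$ is $|G|=\sum_{N\in V}\max(|\mathrm{rhs}_G(N)|,1)$. **Range distinct counting query.** Strings are indexed from $1$. For $T\in\Sigma^N$ and $b,e\in\{0,\ldots,N\}$, the query asks for $\mathrm{distinct}_T(b,e)=|\{T[i]: b<i\le e\}|$. -}

module Defs where

open import Data.Bool.Base using (Bool; true; false; if_then_else_; _∧_; _∨_; _xor_)
open import Data.Fin.Base as Fin using (Fin; toℕ)
open import Data.Fin.Permutation using (Permutation′; _⟨$⟩ʳ_)
open import Data.Fin.Properties as Fin using (any?)
open import Data.Fin.Subset using (Subset; ∣_∣)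
open import Data.Integer.Base as ℤ using ()
open import Data.List.Base as List using (List; []; _∷_; _++_; length)
open import Data.List.Membership.Propositional using (_∈_)
open import Data.Nat.Base
open import Data.Nat.DivMod using (_/_; _%_)
open import Data.Nat.Logarithm using (⌊log₂_⌋)
open import Data.Nat.Properties using (m^n≢0; _≟_; _≤?_; _<?_)
open import Data.Product.Base using (Σ-syntax; ∃-syntax; _×_; _,_)
open import Data.Rational.Unnormalised.Base as ℚ using (ℚᵘ; ↥_; ↧ₙ_)
open import Data.Sum.Base using (_⊎_; inj₁; inj₂)
open import Data.Vec.Base as Vec using (Vec; lookup; tabulate)
import Data.Vec.Membership.Propositional as Vec
open import Data.Vec.Relation.Unary.Unique.Propositional using (Unique)
open import Relation.Binary.Construct.Closure.ReflexiveTransitive using (Star)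
open import Relation.Binary.PropositionalEquality.Core using (_≡_; _≢_)
open import Relation.Nullary.Decidable.Core using (does; _×-dec_)
open import Relation.Nullary.Negation.Core using (¬_)

------------------------------------------------------------------------
-- Asymptotics.  The real constants ε, κ > 0 range over positive rationals: the
-- statements below are monotone in them, so this is no restriction.

-- The binary logarithm, rounded to an integer that is Θ(log n) and never 0,
-- so that a bound O(f · log^c n) is not vacuously unattainable at n = 1.
lg : ℕ → ℕ
lg n = suc ⌊log₂ n ⌋

-- t ≤ K · m ^ (a - ε), without real powers: for ε = p / q > 0 multiply by
-- m ^ ε and raise both sides to the power q.
_≤[_·_^_-_] : (t K m a : ℕ) (ε : ℚᵘ) → Set
t ≤[ K · m ^ a - ε ] = t ^ ↧ₙ ε * m ^ ℤ.∣ ↥ ε ∣ ≤ (K * m ^ a) ^ ↧ₙ ε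

-- σ ≥ κ (N / log N)^{1/2}, squared and cleared of denominators.
LargeAlphabet : (κ : ℚᵘ) (σ N : ℕ) → Set
LargeAlphabet κ σ N = ℤ.∣ ↥ κ ∣ ^ 2 * N ≤ ↧ₙ κ ^ 2 * (σ ^ 2 * lg N)

------------------------------------------------------------------------
-- The word RAM with w-bit words: words are naturals below 2 ^ w and
-- arithmetic wraps around.  Programs are structured (while-programs);
-- together with jump-based machine code these simulate each other with
-- constant-factor overhead.

Reg : Set
Reg = ℕ

data Op : Set where
  add sub mul div mod and or xor shl shr lt eq : Op

infixr 4 _⨾_

data Program : Set where
  skip       : Program
  set        : Reg → ℕ → Program               -- r := constant
  move       : Reg → Reg → Program             -- r := s
  op         : Op → Reg → Reg → Reg → Program  -- r := s ∘ t
  load       : Reg → Reg → Program             -- r := mem[s]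
  store      : Reg → Reg → Program             -- mem[r] := s
  _⨾_        : Program → Program → Program
  ifNonzero  : Reg → Program → Program → Program
  whileNonzero : Reg → Program → Program

record State : Set where
  constructor ⟨_,_⟩
  field
    regs mem : ℕ → ℕ
open State public

toWord : (w : ℕ) → ℕ → ℕ
toWord w x = _%_ x (2 ^ w) {{m^n≢0 2 w}}

toBit : Bool → ℕ
toBit b = if b then 1 else 0

bitwise : (Bool → Bool → Bool) → (w x y : ℕ) → ℕ
bitwise f zero    x y = 0
bitwise f (suc w) x y =
  toBit (f (x % 2 ≡ᵇ 1) (y % 2 ≡ᵇ 1)) + 2 * bitwise f w (x / 2) (y / 2)

-- The exact result on words x and y, before reduction modulo 2 ^ w.  Division
-- and remainder by 0 give 0.
⟦_⟧ : Op → (w x y : ℕ) → ℕ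
⟦ add ⟧ w x y       = x + y
⟦ sub ⟧ w x y       = 2 ^ w + x ∸ y
⟦ mul ⟧ w x y       = x * y
⟦ div ⟧ w x zero    = 0
⟦ div ⟧ w x (suc y) = x / suc y
⟦ mod ⟧ w x zero    = 0
⟦ mod ⟧ w x (suc y) = x % suc y
⟦ and ⟧ w x y       = bitwise _∧_ w x y
⟦ or  ⟧ w x y       = bitwise _∨_ w x y
⟦ xor ⟧ w x y       = bitwise _xor_ w x y
⟦ shl ⟧ w x y       = x * 2 ^ y
⟦ shr ⟧ w x y       = _/_ x (2 ^ y) {{m^n≢0 2 y}}
⟦ lt  ⟧ w x y       = toBit (x <ᵇ y)
⟦ eq  ⟧ w x y       = toBit (x ≡ᵇ y)

_[_↦_] : (ℕ → ℕ) → ℕ → ℕ → (ℕ → ℕ)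
(f [ i ↦ x ]) j = if i ≡ᵇ j then x else f j

-- w ⊢ P , s ⇓[ t ] s′: with w-bit words, P started in s halts in s′ after
-- t elementary steps.
infix 3 _⊢_,_⇓[_]_

data _⊢_,_⇓[_]_ (w : ℕ) : Program → State → ℕ → State → Set where
  skip  : ∀ {s} → w ⊢ skip , s ⇓[ 1 ] s
  set   : ∀ {f m r x} →
          w ⊢ set r x , ⟨ f , m ⟩ ⇓[ 1 ] ⟨ f [ r ↦ toWord w x ] , m ⟩
  move  : ∀ {f m r a} →
          w ⊢ move r a , ⟨ f , m ⟩ ⇓[ 1 ] ⟨ f [ r ↦ f a ] , m ⟩
  op    : ∀ {f m o r a b} →
          w ⊢ op o r a b , ⟨ f , m ⟩
            ⇓[ 1 ] ⟨ f [ r ↦ toWord w (⟦ o ⟧ w (f a) (f b)) ] , m ⟩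
  load  : ∀ {f m r a} →
          w ⊢ load r a , ⟨ f , m ⟩ ⇓[ 1 ] ⟨ f [ r ↦ m (f a) ] , m ⟩
  store : ∀ {f m r a} →
          w ⊢ store r a , ⟨ f , m ⟩ ⇓[ 1 ] ⟨ f , m [ f r ↦ f a ] ⟩
  _⨾_   : ∀ {P Q s s′ s″ t u} →
          w ⊢ P , s ⇓[ t ] s′ → w ⊢ Q , s′ ⇓[ u ] s″ →
          w ⊢ P ⨾ Q , s ⇓[ t + u ] s″
  ifYes : ∀ {P Q r s s′ t} → regs s r ≢ 0 →
          w ⊢ P , s ⇓[ t ] s′ → w ⊢ ifNonzero r P Q , s ⇓[ suc t ] s′
  ifNo  : ∀ {P Q r s s′ t} → regs s r ≡ 0 →
          w ⊢ Q , s ⇓[ t ] s′ → w ⊢ ifNonzero r P Q , s ⇓[ suc t ] s′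
  again : ∀ {P r s s′ s″ t u} → regs s r ≢ 0 →
          w ⊢ P , s ⇓[ t ] s′ → w ⊢ whileNonzero r P , s′ ⇓[ u ] s″ →
          w ⊢ whileNonzero r P , s ⇓[ suc (t + u) ] s″
  done  : ∀ {P r s} → regs s r ≡ 0 →
          w ⊢ whileNonzero r P , s ⇓[ 1 ] s

-- Contents of an array holding the listed values as words, followed by zeros.
cells : (w : ℕ) → List ℕ → (ℕ → ℕ)
cells w []       _       = 0
cells w (x ∷ xs) zero    = toWord w x
cells w (x ∷ xs) (suc i) = cells w xs i

------------------------------------------------------------------------
-- Orthogonal Vectors

BitVec : ℕ → Set
BitVec d = Vec (Fin 2) d

inner : ∀ {d} → BitVec d → BitVec d → ℕ
inner x y = Vec.sum (Vec.zipWith (λ a b → toℕ a * toℕ b) x y)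

HasOrthogonalPair : ∀ {n d} → Vec (BitVec d) n → Set
HasOrthogonalPair A = ∃[ x ] ∃[ y ] x Vec.∈ A × y Vec.∈ A × inner x y ≡ 0

-- n and d are passed in registers 0 and 1, the vectors in memory, one
-- coordinate per word.
ovInput : (w : ℕ) → ∀ {n d} → Vec (BitVec d) n → State
ovInput w {n} {d} A =
  ⟨ cells w (n ∷ d ∷ []) , cells w (Vec.toList (Vec.map toℕ (Vec.concat A))) ⟩

-- An algorithm for instances of dimension d = c log n, on words of Θ(log n)
-- bits.  A set of n vectors is a repetition-free enumeration.
record OVAlgorithm (ε : ℚᵘ) (c : ℕ) : Set where
  field
    program  : Program
    wordMult : ℕ
    {{wordMult≢0}} : NonZero wordMult
    K n₀     : ℕ

  wordSize : ℕ → ℕ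
  wordSize n = wordMult * lg n

  field
    correct : ∀ n (A : Vec (BitVec (c * lg n)) n) → Unique A →
      ∃[ t ] ∃[ s ]
        (wordSize n ⊢ program , ovInput (wordSize n) A ⇓[ t ] s)
        × ((HasOrthogonalPair A × regs s 0 ≡ 1)
           ⊎ (¬ HasOrthogonalPair A × regs s 0 ≡ 0))
        × (n₀ ≤ n → t ≤[ K · n ^ 2 - ε ])

OVConjecture : Set
OVConjecture =
  ∀ (ε : ℚᵘ) → ℚ.Positive ε → ∃[ c ] 1 ≤ c × ¬ OVAlgorithm ε c

------------------------------------------------------------------------
-- Straight-line grammars with terminals {1, …, σ}; the element a of Fin σ
-- stands for the terminal 1 + a.

record SLG (σ : ℕ) : Set where
  field
    v     : ℕ
    rhs   : Fin v → List (Fin v ⊎ Fin σ)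
    start : Fin v
    -- order ⟨$⟩ʳ A is the position of A in the ordering N₁, …, N_v.
    order : Permutation′ v
    acyclic : ∀ {A B} → inj₁ B ∈ rhs A → order ⟨$⟩ʳ A Fin.< order ⟨$⟩ʳ B

  Symbol : Set
  Symbol = Fin v ⊎ Fin σ

  size : ℕ
  size = Vec.sum (tabulate λ A → length (rhs A) ⊔ 1)

  data _⟶_ : List Symbol → List Symbol → Set where
    rewriteAt : ∀ α A β → (α ++ inj₁ A ∷ β) ⟶ (α ++ rhs A ++ β)

  _⟶*_ : List Symbol → List Symbol → Set
  _⟶*_ = Star _⟶_

  Represents : ∀ {N} → Vec (Fin σ) N → Set
  Represents T = (inj₁ start ∷ []) ⟶* List.map inj₂ (Vec.toList T)

  -- Terminals are coded as 1, …, σ and nonterminals as σ + 1, …, σ + v.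
  code : Symbol → ℕ
  code (inj₁ A) = suc (σ + toℕ A)
  code (inj₂ a) = suc (toℕ a)

  -- v, σ and the start symbol are passed in registers 0, 1, 2; memory lists
  -- the right-hand sides, each preceded by its length.
  input : (w : ℕ) → State
  input w =
    ⟨ cells w (v ∷ σ ∷ code (inj₁ start) ∷ [])
    , cells w (List.concatMap (λ A → length (rhs A) ∷ List.map code (rhs A))
                              (List.allFin v)) ⟩

------------------------------------------------------------------------
-- Range distinct counting

-- {T[i] : b < i ≤ e}, where T[i] is the element of T at 0-based index i - 1.
symbolsIn : ∀ {σ N} → Vec (Fin σ) N → (b e : ℕ) → Subset σ
symbolsIn T b e = tabulate λ a → does (any? λ i →
  (b <? suc (toℕ i)) ×-dec (suc (toℕ i) ≤? e) ×-dec (lookup T i Fin.≟ a))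

distinct : ∀ {σ N} → Vec (Fin σ) N → (b e : ℕ) → ℕ
distinct T b e = ∣ symbolsIn T b e ∣

queryInput : (w b e : ℕ) (M : ℕ → ℕ) → State
queryInput w b e M = ⟨ cells w (b ∷ e ∷ []) , M ⟩

-- Memories that can arise from M₀ by answering queries one after another; only
-- memory persists between queries.
data Reachable (w : ℕ) (query : Program) (N : ℕ) (M₀ : ℕ → ℕ) :
               (ℕ → ℕ) → Set where
  built   : Reachable w query N M₀ M₀
  queried : ∀ {M b e t s} → Reachable w query N M₀ M → b ≤ N → e ≤ N →
            w ⊢ query , queryInput w b e M ⇓[ t ] s →
            Reachable w query N M₀ (mem s)

-- A data structure on words of Θ(log (|G| + N + σ)) bits, so that a word can
-- hold any grammar symbol and any position in T.
record RangeDistinctDS (κ ε : ℚᵘ) : Set where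
  field
    build query : Program
    wordMult    : ℕ
    {{wordMult≢0}} : NonZero wordMult
    K₁ c₁ K₂ c₂ g₀ : ℕ

  wordSize : ∀ {σ} → SLG σ → ℕ → ℕ
  wordSize {σ} G N = wordMult * lg (SLG.size G + N + σ)

  field
    correct : ∀ {σ N} (G : SLG σ) (T : Vec (Fin σ) N) →
      SLG.Represents G T → LargeAlphabet κ σ N →
      let w = wordSize G N ; g = SLG.size G in
      ∃[ t ] ∃[ s ]
        (w ⊢ build , SLG.input G w ⇓[ t ] s)
        × (g₀ ≤ g → t ≤[ K₁ * lg N ^ c₁ · g ^ 2 - ε ])
        × (∀ {M} → Reachable w query N (mem s) M → ∀ b e → b ≤ N → e ≤ N →
           ∃[ t′ ] ∃[ s′ ]
             (w ⊢ query , queryInput w b e M ⇓[ t′ ] s′)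
             × regs s′ 0 ≡ distinct T b e
             × (g₀ ≤ g → t′ ≤[ K₂ * lg N ^ c₂ · g ^ 1 - ε ]))

{-# OPTIONS --safe #-}

-- For n vectors in {0,1}^d consider, for each vector x, the block of T that concatenates, over the
-- coordinates i with x[i] = 1, a list of all y with y[i] = 1.  Apart from a dummy letter padding all
-- lists to equal length, the letters of the block are the y not orthogonal to x, so the block has
-- n + 1 distinct letters iff no y is orthogonal to x.  Since each list is shared by all blocks, the
-- grammar has size O(n d), and one construction followed by n queries solves OV.
--
-- Because all blocks have the same length, the query positions are arithmetic progressions, and the
-- reduction keeps only a few registers of its own: the whole memory is left to the data structure.

module Submission where

open import Defs
open import Data.Bool.Base using (true; false; T)
open import Data.Empty using (⊥-elim)
open import Data.Fin.Base using (Fin; zero; suc; toℕ; fromℕ; fromℕ<; combine)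
import Data.Fin.Permutation as Permutation
open import Data.Fin.Properties
  using (any?; toℕ<n; toℕ-fromℕ; toℕ-fromℕ<; toℕ-combine; toℕ-injective; combine-surjective)
open import Data.Fin.Subset using (Subset; ∣_∣) renaming (_∈_ to _∈ₛ_)
open import Data.Fin.Subset.Properties using (p⊆q⇒∣p∣≤∣q∣; p⊂q⇒∣p∣<∣q∣)
open import Data.Integer.Base as ℤ using ()
open import Data.List.Base as List using (List; []; _∷_; _++_; length)
open import Data.List.Membership.Propositional using (_∈_)
open import Data.List.Membership.Propositional.Properties using (∈-map⁻)
import Data.List.Properties as List
open import Data.Nat.Base
open import Data.Nat.DivMod hiding (_div_; _mod_)
open import Data.Nat.Induction using (<-rec)
open import Data.Nat.Logarithm
open import Data.Nat.Properties
open import Data.Nat.Tactic.RingSolver using (solve-∀)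
open import Data.Product.Base using (∃-syntax; _×_; _,_; proj₁; proj₂)
open import Data.Rational.Unnormalised.Base using (ℚᵘ; mkℚᵘ; Positive; ↥_; ↧ₙ_)
open import Data.Sum.Base using (_⊎_; inj₁; inj₂)
open import Data.Unit.Base using (tt)
open import Data.Vec.Base as Vec using (Vec; []; _∷_; lookup; tabulate; toList)
import Data.Vec.Membership.Propositional.Properties as Vec
import Data.Vec.Properties as Vec
open import Data.Vec.Relation.Unary.Any using (index)
open import Data.Vec.Relation.Unary.Any.Properties using (lookup-index)
open import Function.Base using (_∘_)
open import Relation.Binary.Construct.Closure.ReflexiveTransitive using (_◅_; _◅◅_; gmap) renaming (ε to ε⋆)
open import Relation.Binary.PropositionalEquality
open import Relation.Nullary.Decidable using (Dec; does; yes; no; dec-true; dec-false)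
open import Relation.Nullary.Negation.Core using (¬_; contradiction)

-- The machine model pins down complete states. The builder's guarantee concerns one exact initial
-- memory, so the grammar has to replace the vectors in place, without scratch cells and without
-- residue; writing from high addresses to low ones makes this possible. Every query expects blank
-- registers, and a program can dirty only a bounded number of them, so they are cleared in constant
-- time. Word sizes must match too: that of the data structure depends on grammar, text and alphabet
-- together, that of the OV algorithm on `n` alone.
--
-- Lists have `n + 1` places rather than `n` so that the dummy occurs in every block. Otherwise `n`
-- distinct letters could mean either all vectors without a dummy, or all but one with it.
--
-- The grammar size `O(n log n)` and the factors `log^c N` cost powers of `log n`. Of the saving
-- `n^(1/q)`, where `q` is the denominator of `ε`, one half absorbs these powers and the other half
-- contradicts the conjecture.

-- Relocated programs and blank registers

-- Registers 0, …, 15 stay free for the code around a program shifted by 16.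
shift : Program → Program
shift skip               = skip
shift (set r x)          = set (16 + r) x
shift (move r a)         = move (16 + r) (16 + a)
shift (op o r a b)       = op o (16 + r) (16 + a) (16 + b)
shift (load r a)         = load (16 + r) (16 + a)
shift (store r a)        = store (16 + r) (16 + a)
shift (P ⨾ Q)            = shift P ⨾ shift Q
shift (ifNonzero r P Q)  = ifNonzero (16 + r) (shift P) (shift Q)
shift (whileNonzero r P) = whileNonzero (16 + r) (shift P)

infix 4 _∼_

-- Only registers are relocated: memory is shared at its old addresses, because the relocated
-- program owns all of it. Agreement is pointwise, as nothing here identifies extensionally equal
-- functions.
record _∼_ (s s₁ : State) : Set where
  constructor agree
  field
    regs∼ : ∀ r → regs s r ≡ regs s₁ (16 + r)
    mem∼  : ∀ a → mem s a ≡ mem s₁ a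
open _∼_ public

LowRegsKept : State → State → Set
LowRegsKept s s₁ = ∀ r → r < 16 → regs s₁ r ≡ regs s r

update-same : ∀ {f f₁ : ℕ → ℕ} i {x x₁} → (∀ r → f r ≡ f₁ r) → x ≡ x₁ →
              ∀ r → (f [ i ↦ x ]) r ≡ (f₁ [ i ↦ x₁ ]) r
update-same i f≗f₁ refl r with i ≡ᵇ r
... | true  = refl
... | false = f≗f₁ r

update-at : ∀ (f : ℕ → ℕ) i x → (f [ i ↦ x ]) i ≡ x
update-at f i x with i ≡ᵇ i in eq
... | true  = refl
... | false = ⊥-elim (subst T eq (≡⇒≡ᵇ i i refl))

update-other : ∀ (f : ℕ → ℕ) i x {j} → i ≢ j → (f [ i ↦ x ]) j ≡ f j
update-other f i x {j} i≢j with i ≡ᵇ j in eq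
... | true  = contradiction (≡ᵇ⇒≡ i j (subst T (sym eq) tt)) i≢j
... | false = refl

shift-update : ∀ {f : ℕ → ℕ} (f₁ : ℕ → ℕ) i {x x₁} → (∀ r → f r ≡ f₁ (16 + r)) → x ≡ x₁ →
               ∀ r → (f [ i ↦ x ]) r ≡ (f₁ [ 16 + i ↦ x₁ ]) (16 + r)
shift-update f₁ i f∼f₁ refl r with i ≡ᵇ r
... | true  = refl
... | false = f∼f₁ r

low-update : ∀ (f : ℕ → ℕ) i x r → r < 16 → (f [ 16 + i ↦ x ]) r ≡ f r
low-update f i x r r<16 =
  update-other f (16 + i) x λ eq → <⇒≱ r<16 (subst (16 ≤_) eq (m≤m+n 16 i))

-- The relocated run executes the same instructions, hence the same `t`. It writes only registers
-- from 16 up, so the variables of the surrounding code survive.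
simulate : ∀ {w P s s′ t s₁} → w ⊢ P , s ⇓[ t ] s′ → s ∼ s₁ →
           ∃[ s₁′ ] (w ⊢ shift P , s₁ ⇓[ t ] s₁′) × s′ ∼ s₁′ × LowRegsKept s₁ s₁′
simulate skip s∼ = _ , skip , s∼ , λ _ _ → refl
simulate {s₁ = s₁} (set {r = r}) (agree R M) =
  _ , set , agree (shift-update (regs s₁) r R refl) M , low-update (regs s₁) r _
simulate {s₁ = s₁} (move {r = r} {a}) (agree R M) =
  _ , move , agree (shift-update (regs s₁) r R (R a)) M , low-update (regs s₁) r _
simulate {w = w} {s₁ = s₁} (op {o = o} {r} {a} {b}) (agree R M) =
  _ , op , agree (shift-update (regs s₁) r R (cong₂ (λ x y → toWord w (⟦ o ⟧ w x y)) (R a) (R b))) M ,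
  low-update (regs s₁) r _
simulate {s₁ = s₁} (load {m = m} {r} {a}) (agree R M) =
  _ , load , agree (shift-update (regs s₁) r R (trans (cong m (R a)) (M _))) M , low-update (regs s₁) r _
simulate {s₁ = s₁} (store {f = f} {m} {r} {a}) (agree R M) =
  _ , store ,
  agree R (λ j → trans (cong (λ i → (m [ i ↦ f a ]) j) (R r))
                       (update-same (regs s₁ (16 + r)) M (R a) j)) ,
  λ _ _ → refl
simulate (p ⨾ q) s∼ =
  let _ , p₁ , s′∼ , keep  = simulate p s∼
      _ , q₁ , s″∼ , keep₁ = simulate q s′∼
  in _ , (p₁ ⨾ q₁) , s″∼ , λ r r< → trans (keep₁ r r<) (keep r r<)
simulate (ifYes {r = r} r≢0 p) s∼ =
  let _ , p₁ , s′∼ , keep = simulate p s∼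
  in _ , ifYes (λ eq → r≢0 (trans (regs∼ s∼ r) eq)) p₁ , s′∼ , keep
simulate (ifNo {r = r} r≡0 p) s∼ =
  let _ , p₁ , s′∼ , keep = simulate p s∼
  in _ , ifNo (trans (sym (regs∼ s∼ r)) r≡0) p₁ , s′∼ , keep
simulate (again {r = r} r≢0 p q) s∼ =
  let _ , p₁ , s′∼ , keep  = simulate p s∼
      _ , q₁ , s″∼ , keep₁ = simulate q s′∼
  in _ , again (λ eq → r≢0 (trans (regs∼ s∼ r) eq)) p₁ q₁ , s″∼ ,
     λ r r< → trans (keep₁ r r<) (keep r r<)
simulate (done {r = r} r≡0) s∼ =
  _ , done (trans (sym (regs∼ s∼ r)) r≡0) , s∼ , λ _ _ → refl

-- Counts written registers only: one that is merely read keeps its initial value.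
regBound : Program → ℕ
regBound skip               = 0
regBound (set r x)          = suc r
regBound (move r a)         = suc r
regBound (op o r a b)       = suc r
regBound (load r a)         = suc r
regBound (store r a)        = 0
regBound (P ⨾ Q)            = regBound P ⊔ regBound Q
regBound (ifNonzero r P Q)  = regBound P ⊔ regBound Q
regBound (whileNonzero r P) = regBound P

untouched : ∀ {w P s s′ t} → w ⊢ P , s ⇓[ t ] s′ →
            ∀ r → regBound P ≤ r → regs s′ r ≡ regs s r
untouched skip r P≤r = refl
untouched (set {f}) r P≤r = update-other f _ _ (<⇒≢ P≤r)
untouched (move {f}) r P≤r = update-other f _ _ (<⇒≢ P≤r)
untouched (op {f}) r P≤r = update-other f _ _ (<⇒≢ P≤r)
untouched (load {f}) r P≤r = update-other f _ _ (<⇒≢ P≤r)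
untouched store r P≤r = refl
untouched (_⨾_ {P} {Q} p q) r P≤r =
  trans (untouched q r (m⊔n≤o⇒n≤o (regBound P) _ P≤r)) (untouched p r (m⊔n≤o⇒m≤o _ (regBound Q) P≤r))
untouched (ifYes {P} {Q} _ p) r P≤r = untouched p r (m⊔n≤o⇒m≤o _ (regBound Q) P≤r)
untouched (ifNo {P} {Q} _ q) r P≤r = untouched q r (m⊔n≤o⇒n≤o (regBound P) _ P≤r)
untouched (again _ p q) r P≤r = trans (untouched q r P≤r) (untouched p r P≤r)
untouched (done _) r P≤r = refl

-- Every query assumes zeros outside its two arguments. Earlier runs can have dirtied only a fixed
-- number of registers, so a loop-free program of constant length restores this.
clear : ℕ → Program
clear zero    = skip
clear (suc B) = clear B ⨾ set (16 + B) 0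

record Cleared (B : ℕ) (s s′ : State) : Set where
  field
    low   : LowRegsKept s s′
    zeros : ∀ r → r < B → regs s′ (16 + r) ≡ 0
    high  : ∀ r → B ≤ r → regs s′ (16 + r) ≡ regs s (16 + r)
    same  : mem s′ ≡ mem s
open Cleared public

toWord-small : ∀ w {x} → x < 2 ^ w → toWord w x ≡ x
toWord-small w = m<n⇒m%n≡m {{m^n≢0 2 w}}

clear-run : ∀ w B s → ∃[ s′ ] (w ⊢ clear B , s ⇓[ suc B ] s′) × Cleared B s s′
clear-run w zero s = s , skip , record
  { low = λ _ _ → refl ; zeros = λ _ () ; high = λ _ _ → refl ; same = refl }
clear-run w (suc B) s with s′ , run , c ← clear-run w B s =
  _ , subst (λ t → w ⊢ clear (suc B) , s ⇓[ t ] s″) (+-comm (suc B) 1) (run ⨾ set) , record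
    { low   = λ r r<16 → trans (low-update f B _ r r<16) (low c r r<16)
    ; zeros = zeros′
    ; high  = λ r B<r → trans (update-other f (16 + B) _ (λ eq → <⇒≢ B<r (+-cancelˡ-≡ 16 _ _ eq)))
                              (high c r (<⇒≤ B<r))
    ; same  = same c }
  where
  f  = regs s′
  s″ = ⟨ f [ 16 + B ↦ toWord w 0 ] , mem s′ ⟩
  zeros′ : ∀ r → r < suc B → regs s″ (16 + r) ≡ 0
  zeros′ r r≤B with m≤n⇒m<n∨m≡n (s≤s⁻¹ r≤B)
  ... | inj₁ r<B  = trans (update-other f (16 + B) _ (λ eq → <⇒≢ r<B (sym (+-cancelˡ-≡ 16 _ _ eq))))
                          (zeros c r r<B)
  ... | inj₂ refl = trans (update-at f (16 + r) _) (toWord-small w (m^n>0 2 w))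

-- Instructions without overflow, and counted loops

toBit≤1 : ∀ b → toBit b ≤ 1
toBit≤1 true  = s≤s z≤n
toBit≤1 false = z≤n

module _ {w : ℕ} where

  op-run : ∀ {f m a b x y z} o r → f a ≡ x → f b ≡ y → toWord w (⟦ o ⟧ w x y) ≡ z →
           w ⊢ op o r a b , ⟨ f , m ⟩ ⇓[ 1 ] ⟨ f [ r ↦ z ] , m ⟩
  op-run o r refl refl refl = op

  set-run : ∀ {f m x} r → x < 2 ^ w → w ⊢ set r x , ⟨ f , m ⟩ ⇓[ 1 ] ⟨ f [ r ↦ x ] , m ⟩
  set-run {f} {m} {x} r x< =
    subst (λ z → w ⊢ set r x , ⟨ f , m ⟩ ⇓[ 1 ] ⟨ f [ r ↦ z ] , m ⟩) (toWord-small w x<) set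

  move-run : ∀ {f m a x} r → f a ≡ x → w ⊢ move r a , ⟨ f , m ⟩ ⇓[ 1 ] ⟨ f [ r ↦ x ] , m ⟩
  move-run r refl = move

  load-run : ∀ {f m a i x} r → f a ≡ i → m i ≡ x →
             w ⊢ load r a , ⟨ f , m ⟩ ⇓[ 1 ] ⟨ f [ r ↦ x ] , m ⟩
  load-run r refl refl = load

  store-run : ∀ {f m r a i x} → f r ≡ i → f a ≡ x →
              w ⊢ store r a , ⟨ f , m ⟩ ⇓[ 1 ] ⟨ f , m [ i ↦ x ] ⟩
  store-run refl refl = store

  word : ∀ {x z} → x ≡ z → z < 2 ^ w → toWord w x ≡ z
  word refl = toWord-small w

  add-run : ∀ {f m a b x y} z r → f a ≡ x → f b ≡ y → x + y ≡ z → z < 2 ^ w →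
            w ⊢ op add r a b , ⟨ f , m ⟩ ⇓[ 1 ] ⟨ f [ r ↦ z ] , m ⟩
  add-run z r p q e l = op-run add r p q (word e l)

  mul-run : ∀ {f m a b x y} z r → f a ≡ x → f b ≡ y → x * y ≡ z → z < 2 ^ w →
            w ⊢ op mul r a b , ⟨ f , m ⟩ ⇓[ 1 ] ⟨ f [ r ↦ z ] , m ⟩
  mul-run z r p q e l = op-run mul r p q (word e l)

  sub-word : ∀ {x y} → y ≤ x → x < 2 ^ w → toWord w (2 ^ w + x ∸ y) ≡ x ∸ y
  sub-word {x} {y} y≤x x< = begin
    toWord w (2 ^ w + x ∸ y)    ≡⟨ cong (toWord w) (trans (+-∸-assoc (2 ^ w) y≤x) (+-comm (2 ^ w) _)) ⟩
    toWord w ((x ∸ y) + 2 ^ w)  ≡⟨ [m+n]%n≡m%n (x ∸ y) (2 ^ w) {{m^n≢0 2 w}} ⟩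
    toWord w (x ∸ y)            ≡⟨ toWord-small w (≤-<-trans (m∸n≤m x y) x<) ⟩
    x ∸ y                       ∎
    where open ≡-Reasoning

  sub-run : ∀ {f m a b x y} z r → f a ≡ x → f b ≡ y → x ∸ y ≡ z → y ≤ x → x < 2 ^ w →
            w ⊢ op sub r a b , ⟨ f , m ⟩ ⇓[ 1 ] ⟨ f [ r ↦ z ] , m ⟩
  sub-run z r p q e y≤x x< = op-run sub r p q (trans (sub-word y≤x x<) e)

  div-run : ∀ {f m a b x y} .{{_ : NonZero y}} r → f a ≡ x → f b ≡ y → x < 2 ^ w →
            w ⊢ op div r a b , ⟨ f , m ⟩ ⇓[ 1 ] ⟨ f [ r ↦ x / y ] , m ⟩
  div-run {x = x} {y = suc y} r p q x< =
    op-run div r p q (toWord-small w (≤-<-trans (m/n≤m x (suc y)) x<))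

  mod-run : ∀ {f m a b x y} .{{_ : NonZero y}} r → f a ≡ x → f b ≡ y → x < 2 ^ w →
            w ⊢ op mod r a b , ⟨ f , m ⟩ ⇓[ 1 ] ⟨ f [ r ↦ x % y ] , m ⟩
  mod-run {x = x} {y = suc y} r p q x< =
    op-run mod r p q (toWord-small w (≤-<-trans (m%n≤m x (suc y)) x<))

  lt-run : ∀ {f m a b x y} r → f a ≡ x → f b ≡ y → 1 < 2 ^ w →
           w ⊢ op lt r a b , ⟨ f , m ⟩ ⇓[ 1 ] ⟨ f [ r ↦ toBit (x <ᵇ y) ] , m ⟩
  lt-run {x = x} {y} r p q 1< = op-run lt r p q (toWord-small w (≤-<-trans (toBit≤1 (x <ᵇ y)) 1<))

  eq-run : ∀ {f m a b x y} r → f a ≡ x → f b ≡ y → 1 < 2 ^ w →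
           w ⊢ op eq r a b , ⟨ f , m ⟩ ⇓[ 1 ] ⟨ f [ r ↦ toBit (x ≡ᵇ y) ] , m ⟩
  eq-run {x = x} {y} r p q 1< = op-run eq r p q (toWord-small w (≤-<-trans (toBit≤1 (x ≡ᵇ y)) 1<))

  -- All iterations are charged the cost `u` of the most expensive one. Since `u` is an actual cost,
  -- or 0 for the empty loop, it inherits `Q` whatever `Q` is.
  countdown : ∀ {c body} (Inv : ℕ → State → Set) (Q : ℕ → Set) → Q 0 →
    (∀ {k s} → Inv k s → regs s c ≡ k) →
    (∀ {k s} → Inv (suc k) s →
      ∃[ t ] ∃[ s′ ] (w ⊢ body , s ⇓[ t ] s′) × Inv k s′ × Q t) →
    ∀ k {s} → Inv k s →
    ∃[ t ] ∃[ s′ ] (w ⊢ whileNonzero c body , s ⇓[ t ] s′) × Inv 0 s′ ×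
      ∃[ u ] Q u × t ≤ suc (k * suc u)
  countdown Inv Q q₀ ctr step zero inv = 1 , _ , done (ctr inv) , inv , 0 , q₀ , ≤-refl
  countdown {c} {body} Inv Q q₀ ctr step (suc k) {s} inv
    with t , s₁ , run , inv₁ , qt ← step inv
    with t′ , s₂ , run′ , inv₂ , u , qu , t′≤ ← countdown {c} {body} Inv Q q₀ ctr step k inv₁
    = suc (t + t′) , s₂ , again (λ eq → 1+n≢0 (trans (sym (ctr inv)) eq)) run run′ , inv₂ ,
      t ⊔ u , larger , s≤s bound
    where
    larger : Q (t ⊔ u)
    larger with ⊔-sel t u
    ... | inj₁ e = subst Q (sym e) qt
    ... | inj₂ e = subst Q (sym e) qu
    bound : t + t′ ≤ suc k * suc (t ⊔ u)
    bound = begin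
      t + t′                            ≤⟨ +-mono-≤ (m≤m⊔n t u) t′≤ ⟩
      t ⊔ u + suc (k * suc u)           ≡⟨ +-suc (t ⊔ u) _ ⟩
      suc (t ⊔ u) + k * suc u           ≤⟨ +-monoʳ-≤ (suc (t ⊔ u)) (*-monoʳ-≤ k (s≤s (m≤n⊔m t u))) ⟩
      suc (t ⊔ u) + k * suc (t ⊔ u)     ∎
      where open ≤-Reasoning

-- The grammar written in place

-- The cells off, …, off + len - 1 of M₀ are being overwritten with the values of V,
-- from the last one down; k of them are still to be written.
record Written (M₀ V : ℕ → ℕ) (off len k : ℕ) (m : ℕ → ℕ) : Set where
  field
    below : ∀ a → a < off + k → m a ≡ M₀ a
    written : ∀ j → k ≤ j → j < len → m (off + j) ≡ V j
    above : ∀ a → off + len ≤ a → m a ≡ M₀ a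

write-cell : ∀ {M₀ V off len k m} → k < len → Written M₀ V off len (suc k) m →
             Written M₀ V off len k (m [ off + k ↦ V k ])
write-cell {M₀} {V} {off} {len} {k} {m} k<len W = record
  { below = λ a a< → trans (update-other m _ _ (λ eq → <⇒≢ a< (sym eq)))
                           (W.below a (<-trans a< (+-monoʳ-< off (n<1+n k))))
  ; written = written′
  ; above = λ a len≤a → trans (update-other m _ _ (<⇒≢ (<-≤-trans (+-monoʳ-< off k<len) len≤a)))
                              (W.above a len≤a)
  }
  where
  module W = Written W
  written′ : ∀ j → k ≤ j → j < len → (m [ off + k ↦ V k ]) (off + j) ≡ V j
  written′ j k≤j j< with m≤n⇒m<n∨m≡n k≤j
  ... | inj₁ k<j  = trans (update-other m _ _ (λ eq → <⇒≢ k<j (+-cancelˡ-≡ off _ _ eq))) (W.written j k<j j<)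
  ... | inj₂ refl = update-at m (off + k) _

write-none : ∀ M₀ V off len → Written M₀ V off len len M₀
write-none M₀ V off len = record
  { below = λ _ _ → refl
  ; written = λ j len≤j j<len → contradiction j<len (≤⇒≯ len≤j)
  ; above = λ _ _ → refl }

-- Registers: 0 n, 1 d, 2 the constant 1, 3 n d, 4 the length n + 2 of a stored row,
-- 5 the address n d + 1 of the first row, 6 the code of the all-dummy nonterminal,
-- 7 a countdown, 13 the constant 0, 14 σ = 2 ^ (k d - 1).
setup : ℕ → Program
setup k =
  set 2 1 ⨾ op mul 3 0 1 ⨾ op add 4 0 2 ⨾ op add 4 4 2 ⨾ op add 5 3 2 ⨾
  set 14 k ⨾ op mul 14 14 1 ⨾ op sub 14 14 2 ⨾ op shl 14 2 14 ⨾
  op add 6 14 2 ⨾ op add 6 6 2 ⨾ op add 6 6 1 ⨾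
  op add 7 1 2 ⨾ op mul 7 7 4

-- Cell j of the rows depends only on bits stored at lower addresses, so the grammar can be
-- written over the input from the top down.
writeRow : Program
writeRow =
  op sub 7 7 2 ⨾ op div 8 7 4 ⨾ op mod 9 7 4 ⨾
  op mul 10 9 1 ⨾ op add 10 10 8 ⨾ op sub 10 10 1 ⨾ load 11 10 ⨾
  op lt 12 8 1 ⨾ op mul 11 11 12 ⨾ op mul 11 11 9 ⨾
  op eq 12 9 13 ⨾ op mul 12 12 0 ⨾ op add 11 11 12 ⨾ op add 11 11 2 ⨾
  op add 10 5 7 ⨾ store 10 11

-- Cell `1 + j` receives the symbol determined by bit `j`. Going down, each write destroys at most a
-- bit that was read one iteration earlier.
writeStart : Program
writeStart =
  op sub 7 7 2 ⨾ op mod 8 7 1 ⨾ op sub 8 1 8 ⨾ load 9 7 ⨾ op mul 9 9 8 ⨾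
  op sub 9 6 9 ⨾ op add 10 2 7 ⨾ store 10 9

-- Registers 8, 9, 10 and 11 become the query position b, the number of hits, the stride and
-- the threshold n + 1.
handOver : Program
handOver =
  op add 16 1 2 ⨾ op add 16 16 2 ⨾ move 17 14 ⨾ op add 18 14 2 ⨾
  move 7 0 ⨾ move 8 13 ⨾ move 9 13 ⨾ op add 10 3 1 ⨾ op add 11 0 2

-- Rows come first, since both loops read the bits and the second one overwrites them. Cell 0 gets
-- the length `n d` only afterwards, as it holds bit 0 until then.
writeGrammar : ℕ → Program
writeGrammar k =
  setup k ⨾ whileNonzero 7 writeRow ⨾ move 7 3 ⨾ whileNonzero 7 writeStart ⨾
  store 13 3 ⨾ handOver

module GrammarWriter
  (w n d σ k : ℕ) {{_ : NonZero d}} (bits : ℕ → ℕ)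
  (bits≤1 : ∀ a → bits a ≤ 1)
  (k≥1 : 1 ≤ k) (σ≡ : σ ≡ 2 ^ (k * d ∸ 1)) (kd< : k * d < 2 ^ w)
  (fits : σ + 2 * ((2 + n) * (2 + d)) < 2 ^ w)
  where

  rowsLength : ℕ
  rowsLength = suc d * (2 + n)

  -- One less than cell `p` in the encoding of row `i`. For `p = 0` that cell is the length `n + 1`;
  -- otherwise it is the code of letter `p` or of the dummy, as decided by bit `i` of vector
  -- `p - 1`. The comparison with `d` blanks row `d`.
  rowEntry : ℕ → ℕ → ℕ
  rowEntry i p = bits (p * d + i ∸ d) * toBit (i <ᵇ d) * p + toBit (p ≡ᵇ 0) * n

  rowCell : ℕ → ℕ
  rowCell j = suc (rowEntry (j / (2 + n)) (j % (2 + n)))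

  -- Row `i` has the nonterminal code `2 + σ + i`. A set bit lowers the code of row `d` by
  -- `d - j % d`, which gives row `j % d` without branching.
  startCell : ℕ → ℕ
  startCell j = (2 + σ + d) ∸ bits j * (d ∸ j % d)

  record Written-Grammar (m : ℕ → ℕ) : Set where
    field
      start-length : m 0 ≡ n * d
      start-cells  : ∀ j → j < n * d → m (suc j) ≡ startCell j
      row-cells    : ∀ j → j < rowsLength → m (suc (n * d) + j) ≡ rowCell j
      rest         : ∀ a → suc (n * d) + rowsLength ≤ a → m a ≡ bits a

  record Constants (f : ℕ → ℕ) : Set where
    constructor constants
    field
      r0 : f 0 ≡ n
      r1 : f 1 ≡ d
      r2 : f 2 ≡ 1
      r3 : f 3 ≡ n * d
      r4 : f 4 ≡ 2 + n
      r5 : f 5 ≡ suc (n * d)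
      r6 : f 6 ≡ 2 + σ + d
      r13 : f 13 ≡ 0
      r14 : f 14 ≡ σ
      r16+ : ∀ r → f (16 + r) ≡ 0
  open Constants

  Z : ℕ
  Z = (2 + n) * (2 + d)

  2Z< : 2 * Z < 2 ^ w
  2Z< = ≤-<-trans (m≤n+m (2 * Z) σ) fits

  ≤2Z : ∀ {x} → x ≤ 2 * Z → x < 2 ^ w
  ≤2Z x≤ = ≤-<-trans x≤ 2Z<

  -- Reduces a polynomial inequality to an identity for the ring solver, with the difference of the
  -- two sides as `z`.
  by-slack : ∀ {x y} z → x + z ≡ y → x ≤ y
  by-slack {x} z refl = m≤m+n x z

  2n+2≤2Z : 2 + 2 * n ≤ 2 * Z
  2n+2≤2Z = by-slack _ (slack n d)
    where
    slack : ∀ n d → 2 + 2 * n + (6 + 2 * n + 4 * d + 2 * (n * d)) ≡ 2 * ((2 + n) * (2 + d))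
    slack = solve-∀

  d+2≤2Z : 2 + d ≤ 2 * Z
  d+2≤2Z = by-slack _ (slack n d)
    where
    slack : ∀ n d → 2 + d + (6 + 3 * d + 4 * n + 2 * (n * d)) ≡ 2 * ((2 + n) * (2 + d))
    slack = solve-∀

  pd+i≤2Z : (2 + n) * d ≤ 2 * Z
  pd+i≤2Z = by-slack _ (slack n d)
    where
    slack : ∀ n d → (2 + n) * d + (8 + 2 * d + 4 * n + n * d) ≡ 2 * ((2 + n) * (2 + d))
    slack = solve-∀

  total≤2Z : suc (n * d) + suc d * (2 + n) ≤ 2 * Z
  total≤2Z = by-slack _ (slack n d)
    where
    slack : ∀ n d → suc (n * d) + suc d * (2 + n) + (5 + 2 * d + 3 * n) ≡ 2 * ((2 + n) * (2 + d))
    slack = solve-∀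

  nd≤2Z : n * d ≤ 2 * Z
  nd≤2Z = ≤-trans (≤-trans (n≤1+n _) (m≤m+n _ _)) total≤2Z

  1<2^w : 1 < 2 ^ w
  1<2^w = ≤2Z (≤-trans (s≤s z≤n) 2n+2≤2Z)

  n+1<2^w : suc n < 2 ^ w
  n+1<2^w = ≤2Z (≤-trans (≤-trans (n≤1+n _) (+-monoʳ-≤ 2 (m≤m+n n (n + 0)))) 2n+2≤2Z)

  n<2^w : n < 2 ^ w
  n<2^w = <-trans (n<1+n n) n+1<2^w

  code< : 2 + σ + d < 2 ^ w
  code< = ≤-<-trans (≤-trans (≤-reflexive (e σ d)) (+-monoʳ-≤ σ d+2≤2Z)) fits
    where
    e : ∀ σ d → 2 + σ + d ≡ σ + (2 + d)
    e = solve-∀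

  row-step : ∀ {j f m} → j < rowsLength → Constants f → f 7 ≡ suc j →
             Written bits rowCell (suc (n * d)) rowsLength (suc j) m →
             ∃[ f′ ] (w ⊢ writeRow , ⟨ f , m ⟩ ⇓[ 16 ] ⟨ f′ , m [ suc (n * d) + j ↦ rowCell j ] ⟩)
               × Constants f′ × f′ 7 ≡ j
  row-step {j} {f} {m} j< K e7 W =
    _ ,
    (sub-run j 7 e7 (r2 K) refl (s≤s z≤n) (≤-<-trans j< len<) ⨾
     div-run 8 refl (r4 K) j<2^w ⨾
     mod-run 9 refl (r4 K) j<2^w ⨾
     mul-run (p * d) 10 refl (r1 K) refl (≤-<-trans (m≤m+n _ i) (≤2Z addr≤)) ⨾
     add-run (p * d + i) 10 refl refl refl (≤2Z addr≤) ⨾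
     -- The subtraction may wrap around when `p = 0`, so its result is left unevaluated here and
     -- treated in `value`.
     op-run sub 10 refl (r1 K) refl ⨾
     load-run 11 refl refl ⨾
     lt-run 12 refl (r1 K) 1<2^w ⨾
     op-run mul 11 refl refl refl ⨾
     op-run mul 11 refl refl (value p refl) ⨾
     eq-run 12 refl (r13 K) 1<2^w ⨾
     mul-run (toBit (p ≡ᵇ 0) * n) 12 refl (r0 K) refl (≤-<-trans (bit* (toBit≤1 (p ≡ᵇ 0))) n<2^w) ⨾
     add-run (rowEntry i p) 11 refl refl refl (<-trans (n<1+n _) cell<) ⨾
     add-run (rowCell j) 11 refl (r2 K) (+-comm _ 1) cell< ⨾
     add-run (suc (n * d) + j) 10 (r5 K) refl refl
       (≤2Z (≤-trans (+-monoʳ-≤ (suc (n * d)) (<⇒≤ j<)) total≤2Z)) ⨾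
     store-run refl refl) ,
    constants (r0 K) (r1 K) (r2 K) (r3 K) (r4 K) (r5 K) (r6 K) (r13 K) (r14 K) (r16+ K) , refl
    where
    module W = Written W
    i = j / (2 + n)
    p = j % (2 + n)
    len< : rowsLength < 2 ^ w
    len< = ≤2Z (≤-trans (m≤n+m rowsLength (suc (n * d))) total≤2Z)
    j<2^w : j < 2 ^ w
    j<2^w = <-trans j< len<
    i≤d : i ≤ d
    i≤d = s≤s⁻¹ (m<n*o⇒m/o<n j<)
    p≤ : p ≤ suc n
    p≤ = s≤s⁻¹ (m%n<n j (2 + n))
    addr≤ : p * d + i ≤ 2 * Z
    addr≤ = ≤-trans (≤-trans (+-mono-≤ (*-monoˡ-≤ d p≤) i≤d) (≤-reflexive (+-comm (suc n * d) d))) pd+i≤2Z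
    bit* : ∀ {b x} → b ≤ 1 → b * x ≤ x
    bit* {b} {x} b≤1 = ≤-trans (*-monoˡ-≤ x b≤1) (≤-reflexive (*-identityˡ x))
    product≤ : ∀ a → bits a * toBit (i <ᵇ d) ≤ 1
    product≤ a = *-mono-≤ (bits≤1 a) (toBit≤1 (i <ᵇ d))
    cell< : rowCell j < 2 ^ w
    cell< = ≤2Z (≤-trans (s≤s (+-mono-≤ (≤-trans (bit* (product≤ _)) p≤) (bit* (toBit≤1 (p ≡ᵇ 0)))))
                         (≤-trans (≤-reflexive (e n)) 2n+2≤2Z))
      where
      e : ∀ n → suc (suc n + n) ≡ 2 + 2 * n
      e = solve-∀
    -- For p = 0 the address underflows, but then the loaded value is multiplied by 0.
    value : ∀ p′ → p′ ≡ p →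
            toWord w (toWord w (m (toWord w (2 ^ w + (p′ * d + i) ∸ d)) * toBit (i <ᵇ d)) * p′)
              ≡ bits (p′ * d + i ∸ d) * toBit (i <ᵇ d) * p′
    value zero _ = trans (cong (toWord w) (*-zeroʳ (toWord w (m _ * toBit (i <ᵇ d)))))
                         (trans (toWord-small w (m^n>0 2 w)) (sym (*-zeroʳ (bits _ * toBit (i <ᵇ d)))))
    value (suc p′) p≡ = begin-equality
      toWord w (toWord w (m (toWord w (2 ^ w + a ∸ d)) * u) * suc p′)
        ≡⟨ cong (λ a′ → toWord w (toWord w (m a′ * u) * suc p′))
                (sub-word {w} {a} {d} d≤a (≤2Z (subst (λ q → q * d + i ≤ 2 * Z) (sym p≡) addr≤))) ⟩
      toWord w (toWord w (m (a ∸ d) * u) * suc p′)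
        ≡⟨ cong (λ b → toWord w (toWord w (b * u) * suc p′)) (W.below (a ∸ d) a∸d<) ⟩
      toWord w (toWord w (bits (a ∸ d) * u) * suc p′)
        ≡⟨ cong (λ b → toWord w (b * suc p′)) (toWord-small w (≤-<-trans (product≤ _) 1<2^w)) ⟩
      toWord w (bits (a ∸ d) * u * suc p′)
        ≡⟨ toWord-small w (≤-<-trans (≤-trans (bit* (product≤ _)) sp≤) n+1<2^w) ⟩
      bits (a ∸ d) * u * suc p′ ∎
      where
      open ≤-Reasoning
      a = suc p′ * d + i
      u = toBit (i <ᵇ d)
      sp≤ : suc p′ ≤ suc n
      sp≤ = subst (_≤ suc n) (sym p≡) p≤
      d≤a : d ≤ a
      d≤a = ≤-trans (m≤m+n d (p′ * d)) (m≤m+n _ i)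
      -- The fictitious vector `n` is read from address `n d + i`, which can lie among the row
      -- cells. Going down, cells up to index `j` are still unwritten, and `i ≤ j` keeps the address
      -- among them.
      i≤j : i ≤ j
      i≤j = m/n≤m j (2 + n)
      a∸d< : a ∸ d < suc (n * d) + suc j
      a∸d< = begin-strict
        d + p′ * d + i ∸ d     ≡⟨ cong (_∸ d) (+-assoc d (p′ * d) i) ⟩
        d + (p′ * d + i) ∸ d   ≡⟨ m+n∸m≡n d _ ⟩
        p′ * d + i             <⟨ +-mono-≤-< (*-monoˡ-≤ d (s≤s⁻¹ sp≤)) (s≤s i≤j) ⟩
        n * d + suc j          ≤⟨ n≤1+n _ ⟩
        suc (n * d) + suc j    ∎

  start-step : ∀ {j f m} → j < n * d → Constants f → f 7 ≡ suc j → m j ≡ bits j →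
               ∃[ f′ ] (w ⊢ writeStart , ⟨ f , m ⟩ ⇓[ 8 ] ⟨ f′ , m [ 1 + j ↦ startCell j ] ⟩)
                 × Constants f′ × f′ 7 ≡ j
  start-step {j} {f} {m} j< K e7 mj =
    _ ,
    (sub-run j 7 e7 (r2 K) refl (s≤s z≤n) (≤-<-trans j< nd<) ⨾
     mod-run 8 refl (r1 K) (<-trans j< nd<) ⨾
     sub-run (d ∸ j % d) 8 (r1 K) refl refl (<⇒≤ (m%n<n j d)) d< ⨾
     load-run 9 refl mj ⨾
     mul-run (bits j * (d ∸ j % d)) 9 refl refl refl (≤-<-trans prod≤ d<) ⨾
     sub-run (startCell j) 9 (r6 K) refl refl (≤-trans prod≤ (m≤n+m d (2 + σ))) code< ⨾
     add-run (1 + j) 10 (r2 K) refl refl (≤-<-trans j< nd<) ⨾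
     store-run refl refl) ,
    constants (r0 K) (r1 K) (r2 K) (r3 K) (r4 K) (r5 K) (r6 K) (r13 K) (r14 K) (r16+ K) , refl
    where
    nd< : n * d < 2 ^ w
    nd< = ≤2Z nd≤2Z
    d< : d < 2 ^ w
    d< = ≤-<-trans (m≤n+m d (2 + σ)) code<
    prod≤ : bits j * (d ∸ j % d) ≤ d
    prod≤ = ≤-trans (*-mono-≤ (bits≤1 j) (m∸n≤m d (j % d))) (≤-reflexive (*-identityˡ d))

  setup-run : ∀ {f m} → f 0 ≡ n → f 1 ≡ d → (∀ r → f (2 + r) ≡ 0) → k < 2 ^ w →
              ∃[ f′ ] (w ⊢ setup k , ⟨ f , m ⟩ ⇓[ 14 ] ⟨ f′ , m ⟩) × Constants f′ × f′ 7 ≡ rowsLength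
  setup-run {f} {m} e0 e1 e≥2 k< =
    _ ,
    (set-run 2 1<2^w ⨾
     mul-run (n * d) 3 e0 e1 refl (≤2Z nd≤2Z) ⨾
     add-run (1 + n) 4 e0 refl (+-comm n 1) (≤2Z (≤-trans (n≤1+n _) n+2≤)) ⨾
     add-run (2 + n) 4 refl refl (+-comm (1 + n) 1) (≤2Z n+2≤) ⨾
     add-run (suc (n * d)) 5 refl refl (+-comm (n * d) 1) (≤2Z (≤-trans (m≤m+n _ _) total≤2Z)) ⨾
     set-run 14 k< ⨾
     mul-run (k * d) 14 refl e1 refl kd< ⨾
     sub-run (k * d ∸ 1) 14 refl refl refl kd≥1 kd< ⨾
     op-run {z = σ} shl 14 refl refl (word {w} (trans (*-identityˡ _) (sym σ≡)) σ<) ⨾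
     add-run (1 + σ) 6 refl refl (+-comm σ 1) (<-trans (n<1+n _) 2+σ<) ⨾
     add-run (2 + σ) 6 refl refl (+-comm (1 + σ) 1) 2+σ< ⨾
     add-run (2 + σ + d) 6 refl e1 refl code< ⨾
     add-run (suc d) 7 e1 refl (+-comm d 1) (≤2Z (≤-trans (n≤1+n _) d+2≤2Z)) ⨾
     mul-run rowsLength 7 refl refl refl (≤2Z (≤-trans (m≤n+m rowsLength (suc (n * d))) total≤2Z))) ,
    constants e0 e1 refl refl refl refl refl (e≥2 11) refl (λ r → e≥2 (14 + r)) , refl
    where
    n+2≤ : 2 + n ≤ 2 * Z
    n+2≤ = ≤-trans (+-monoʳ-≤ 2 (m≤m+n n _)) 2n+2≤2Z
    2+σ< : 2 + σ < 2 ^ w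
    2+σ< = ≤-<-trans (m≤m+n (2 + σ) d) code<
    σ< : σ < 2 ^ w
    σ< = ≤-<-trans (m≤n+m σ 2) 2+σ<
    kd≥1 : 1 ≤ k * d
    kd≥1 = *-mono-≤ k≥1 (>-nonZero⁻¹ d)

  RowInv : ℕ → State → Set
  RowInv j s = j ≤ rowsLength × Constants (regs s) × regs s 7 ≡ j ×
               Written bits rowCell (suc (n * d)) rowsLength j (mem s)

  row-inv : ∀ {j s} → RowInv (suc j) s →
            ∃[ t ] ∃[ s′ ] (w ⊢ writeRow , s ⇓[ t ] s′) × RowInv j s′ × t ≤ 16
  row-inv {j} {⟨ f , m ⟩} (j< , K , e , W) = after (row-step j< K e W)
    where
    after : ∃[ f′ ] (w ⊢ writeRow , ⟨ f , m ⟩ ⇓[ 16 ] ⟨ f′ , m [ suc (n * d) + j ↦ rowCell j ] ⟩) ×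
                    Constants f′ × f′ 7 ≡ j →
            ∃[ t ] ∃[ s′ ] (w ⊢ writeRow , ⟨ f , m ⟩ ⇓[ t ] s′) × RowInv j s′ × t ≤ 16
    after (f′ , run , K′ , e′) = 16 , _ , run , (<⇒≤ j< , K′ , e′ , write-cell j< W) , ≤-refl

  RowsRun : State → Set
  RowsRun s = ∃[ t ] ∃[ s′ ] (w ⊢ whileNonzero 7 writeRow , s ⇓[ t ] s′) × RowInv 0 s′ ×
                ∃[ u ] u ≤ 16 × t ≤ suc (rowsLength * suc u)

  row-loop : ∀ {s} → RowInv rowsLength s → RowsRun s
  row-loop = countdown RowInv (_≤ 16) z≤n (λ (_ , _ , e , _) → e) row-inv rowsLength

  StartInv : (ℕ → ℕ) → ℕ → State → Set
  StartInv m j s = j ≤ n * d × Constants (regs s) × regs s 7 ≡ j ×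
                   Written m startCell 1 (n * d) j (mem s)

  start-inv : ∀ {m} → (∀ a → a < n * d → m a ≡ bits a) → ∀ {j s} → StartInv m (suc j) s →
              ∃[ t ] ∃[ s′ ] (w ⊢ writeStart , s ⇓[ t ] s′) × StartInv m j s′ × t ≤ 8
  start-inv {m₀} m≗ {j} {⟨ f , m ⟩} (j< , K , e , W) =
    after (start-step j< K e (trans (Written.below W j (m≤n+m (suc j) 1)) (m≗ j j<)))
    where
    after : ∃[ f′ ] (w ⊢ writeStart , ⟨ f , m ⟩ ⇓[ 8 ] ⟨ f′ , m [ 1 + j ↦ startCell j ] ⟩) ×
                    Constants f′ × f′ 7 ≡ j →
            ∃[ t ] ∃[ s′ ] (w ⊢ writeStart , ⟨ f , m ⟩ ⇓[ t ] s′) × StartInv m₀ j s′ × t ≤ 8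
    after (f′ , run , K′ , e′) = 8 , _ , run , (<⇒≤ j< , K′ , e′ , write-cell j< W) , ≤-refl

  StartRun : (ℕ → ℕ) → State → Set
  StartRun m s = ∃[ t ] ∃[ s′ ] (w ⊢ whileNonzero 7 writeStart , s ⇓[ t ] s′) × StartInv m 0 s′ ×
                   ∃[ u ] u ≤ 8 × t ≤ suc (n * d * suc u)

  start-loop : ∀ {m s} → (∀ a → a < n * d → m a ≡ bits a) → StartInv m (n * d) s → StartRun m s
  start-loop {m} m≗ = countdown (StartInv m) (_≤ 8) z≤n (λ (_ , _ , e , _) → e) (start-inv m≗) (n * d)

  record HandedOver (f : ℕ → ℕ) : Set where
    field
      one      : f 2 ≡ 1
      counter  : f 7 ≡ n
      position : f 8 ≡ 0
      found    : f 9 ≡ 0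
      stride   : f 10 ≡ n * d + d
      symbols  : f 11 ≡ 1 + n
      nil      : f 13 ≡ 0
      input₀   : f 16 ≡ 2 + d
      input₁   : f 17 ≡ σ
      input₂   : f 18 ≡ suc σ
      input≥3  : ∀ r → f (19 + r) ≡ 0

  handOver-run : ∀ {f m} → Constants f →
                 ∃[ f′ ] (w ⊢ handOver , ⟨ f , m ⟩ ⇓[ 9 ] ⟨ f′ , m ⟩) × HandedOver f′
  handOver-run {f} K =
    _ ,
    (add-run (1 + d) 16 (r1 K) (r2 K) (+-comm d 1) (<-trans (n<1+n _) d+2<) ⨾
     add-run (2 + d) 16 refl (r2 K) (+-comm (1 + d) 1) d+2< ⨾
     move-run 17 (r14 K) ⨾
     add-run (suc σ) 18 (r14 K) (r2 K) (+-comm σ 1) (≤-<-trans (m≤m+n (suc σ) d) (<-trans (n<1+n _) code<)) ⨾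
     move-run 7 (r0 K) ⨾
     move-run 8 (r13 K) ⨾
     move-run 9 (r13 K) ⨾
     add-run (n * d + d) 10 (r3 K) (r1 K) refl stride< ⨾
     add-run (1 + n) 11 (r0 K) (r2 K) (+-comm n 1) n+1<2^w) ,
    record
      { one = r2 K ; counter = refl ; position = refl ; found = refl ; stride = refl
      ; symbols = refl ; nil = r13 K ; input₀ = refl ; input₁ = refl ; input₂ = refl
      ; input≥3 = λ r → r16+ K (3 + r) }
    where
    d+2< : 2 + d < 2 ^ w
    d+2< = ≤2Z d+2≤2Z
    stride< : n * d + d < 2 ^ w
    stride< = ≤2Z (≤-trans (≤-trans (≤-reflexive (+-comm (n * d) d)) (m≤n+m _ d)) pd+i≤2Z)

  GrammarReady : ℕ → State → Set
  GrammarReady t s = HandedOver (regs s) × Written-Grammar (mem s) ×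
                     t ≤ 27 + (rowsLength * 17 + n * d * 9)

  writeGrammar-run : ∀ {f} → f 0 ≡ n → f 1 ≡ d → (∀ r → f (2 + r) ≡ 0) → k < 2 ^ w →
    ∃[ t ] ∃[ s ] (w ⊢ writeGrammar k , ⟨ f , bits ⟩ ⇓[ t ] s) × GrammarReady t s
  writeGrammar-run {f} e0 e1 e≥2 k< = after-setup (setup-run {m = bits} e0 e1 e≥2 k<)
    where
    -- The 27 steps are 14 of `setup`, 9 of `handOver`, the final tests of both loops, one `move`
    -- and one `store`.
    time : ∀ {x y a b} → x ≤ suc a → y ≤ suc b → 14 + (x + (1 + (y + (1 + 9)))) ≤ 27 + (a + b)
    time {x} {y} {a} {b} x≤ y≤ = ≤-trans
      (+-monoʳ-≤ 14 (+-mono-≤ x≤ (+-monoʳ-≤ 1 (+-monoˡ-≤ 10 y≤))))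
      (≤-reflexive (e a b))
      where
      e : ∀ a b → 14 + (suc a + (1 + (suc b + 10))) ≡ 27 + (a + b)
      e = solve-∀

    Goal : Set
    Goal = ∃[ t ] ∃[ s ] (w ⊢ writeGrammar k , ⟨ f , bits ⟩ ⇓[ t ] s) × GrammarReady t s

    after-setup : ∃[ f₁ ] (w ⊢ setup k , ⟨ f , bits ⟩ ⇓[ 14 ] ⟨ f₁ , bits ⟩) ×
                    Constants f₁ × f₁ 7 ≡ rowsLength → Goal
    after-setup (f₁ , run₁ , K₁ , e7) =
      after-rows (row-loop (≤-refl , K₁ , e7 , write-none bits rowCell (suc (n * d)) rowsLength))
      where
      after-rows : RowsRun ⟨ f₁ , bits ⟩ → Goal
      after-rows (t₂ , ⟨ f₂ , m₂ ⟩ , run₂ , (_ , K₂ , _ , W₂) , u₂ , u₂≤ , t₂≤) =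
        after-start (start-loop
          (λ a a< → Written.below W₂ a (≤-trans (m≤n⇒m≤1+n a<) (m≤m+n _ 0)))
          (≤-refl ,
           constants (r0 K₂) (r1 K₂) (r2 K₂) (r3 K₂) (r4 K₂) (r5 K₂) (r6 K₂) (r13 K₂) (r14 K₂) (r16+ K₂) ,
           refl , write-none m₂ startCell 1 (n * d)))
        where
        after-start : StartRun m₂ ⟨ f₂ [ 7 ↦ n * d ] , m₂ ⟩ → Goal
        after-start (t₃ , ⟨ f₃ , m₃ ⟩ , run₃ , (_ , K₃ , _ , W₃) , u₃ , u₃≤ , t₃≤) =
          after-handOver (handOver-run {m = m₃ [ 0 ↦ n * d ]} K₃)
          where
          after-handOver : ∃[ f₄ ] (w ⊢ handOver , ⟨ f₃ , m₃ [ 0 ↦ n * d ] ⟩ ⇓[ 9 ] ⟨ f₄ , m₃ [ 0 ↦ n * d ] ⟩) ×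
                             HandedOver f₄ → Goal
          after-handOver (f₄ , run₄ , H) = _ , _ ,
            (run₁ ⨾ run₂ ⨾ move-run 7 (r3 K₂) ⨾ run₃ ⨾ store-run (r13 K₃) (r3 K₃) ⨾ run₄) ,
            H ,
            record
              { start-length = refl
              ; start-cells  = λ j j< → Written.written W₃ j z≤n j<
              ; row-cells    = λ j j< → trans (Written.above W₃ (suc (n * d) + j) (m≤m+n _ j))
                                              (Written.written W₂ j z≤n j<)
              ; rest         = λ { (suc a) a≥ →
                  trans (Written.above W₃ (suc a) (≤-trans (m≤m+n _ rowsLength) a≥)) (Written.above W₂ (suc a) a≥) }
              } ,
            time (≤-trans t₂≤ (s≤s (*-monoʳ-≤ rowsLength (s≤s u₂≤))))
                 (≤-trans t₃≤ (s≤s (*-monoʳ-≤ (n * d) (s≤s u₃≤))))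

-- Lists as memory contents

module _ (w : ℕ) where

  cells-++ˡ : ∀ xs ys {i} → i < length xs → cells w (xs ++ ys) i ≡ cells w xs i
  cells-++ˡ (x ∷ xs) ys {zero}  _  = refl
  cells-++ˡ (x ∷ xs) ys {suc i} i< = cells-++ˡ xs ys (s≤s⁻¹ i<)

  cells-++ʳ : ∀ xs ys i → cells w (xs ++ ys) (length xs + i) ≡ cells w ys i
  cells-++ʳ []       ys i = refl
  cells-++ʳ (x ∷ xs) ys i = cells-++ʳ xs ys i

  cells-beyond : ∀ xs {i} → length xs ≤ i → cells w xs i ≡ 0
  cells-beyond []       _          = refl
  cells-beyond (x ∷ xs) {suc i} le = cells-beyond xs (s≤s⁻¹ le)

  cells-toList : ∀ {n} (xs : Vec ℕ n) i → cells w (toList xs) (toℕ i) ≡ toWord w (lookup xs i)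
  cells-toList (x ∷ xs) zero    = refl
  cells-toList (x ∷ xs) (suc i) = cells-toList xs i

  cells-concat : ∀ {n m} (xss : Fin n → List ℕ) → (∀ i → length (xss i) ≡ m) →
                 ∀ i {j} → j < m →
                 cells w (List.concat (List.tabulate xss)) (toℕ i * m + j) ≡ cells w (xss i) j
  cells-concat xss len zero    j< = cells-++ˡ (xss zero) _ (subst (_ <_) (sym (len zero)) j<)
  cells-concat {m = m} xss len (suc i) {j} j< = begin
    cells w (xss zero ++ rest) (m + toℕ i * m + j)
      ≡⟨ cong (cells w (xss zero ++ rest)) (trans (+-assoc m _ j) (cong (_+ (toℕ i * m + j)) (sym (len zero)))) ⟩
    cells w (xss zero ++ rest) (length (xss zero) + (toℕ i * m + j))
      ≡⟨ cells-++ʳ (xss zero) rest _ ⟩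
    cells w rest (toℕ i * m + j)
      ≡⟨ cells-concat (xss ∘ suc) (len ∘ suc) i j< ⟩
    cells w (xss (suc i)) j ∎
    where
    open ≡-Reasoning
    rest = List.concat (List.tabulate (xss ∘ suc))

length-concat-tabulate : ∀ {a} {X : Set a} {n m} (xss : Fin n → List X) → (∀ i → length (xss i) ≡ m) →
                         length (List.concat (List.tabulate xss)) ≡ n * m
length-concat-tabulate {n = zero}  xss len = refl
length-concat-tabulate {n = suc n} xss len =
  trans (List.length-++ (xss zero)) (cong₂ _+_ (len zero) (length-concat-tabulate (xss ∘ suc) (len ∘ suc)))

toList-concat : ∀ {a} {X : Set a} {n m} (xss : Vec (Vec X m) n) →
                toList (Vec.concat xss) ≡ List.concat (List.map toList (toList xss))
toList-concat []         = refl
toList-concat (xs ∷ xss) = trans (Vec.toList-++ xs _) (cong (toList xs ++_) (toList-concat xss))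

sum-tabulate-const : ∀ {n} c (f : Fin n → ℕ) → (∀ i → f i ≡ c) → Vec.sum (tabulate f) ≡ n * c
sum-tabulate-const {zero}  c f f≡ = refl
sum-tabulate-const {suc n} c f f≡ = cong₂ _+_ (f≡ zero) (sum-tabulate-const c (f ∘ suc) (f≡ ∘ suc))

-- Derivations in context

module Derivations {σ} (G : SLG σ) where
  open SLG G

  step-context : ∀ α β {γ δ} → γ ⟶ δ → (α ++ γ ++ β) ⟶ (α ++ δ ++ β)
  step-context α β (rewriteAt α′ A β′) =
    subst₂ _⟶_ (reassoc (inj₁ A ∷ [])) (reassoc (rhs A)) (rewriteAt (α ++ α′) A (β′ ++ β))
    where
    reassoc : ∀ μ → (α ++ α′) ++ μ ++ (β′ ++ β) ≡ α ++ (α′ ++ μ ++ β′) ++ β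
    reassoc μ = trans (List.++-assoc α α′ _)
      (cong (α ++_) (trans (cong (α′ ++_) (sym (List.++-assoc μ β′ β))) (sym (List.++-assoc α′ (μ ++ β′) β))))

  derive-++ : ∀ {γ δ γ′ δ′} → γ ⟶* δ → γ′ ⟶* δ′ → (γ ++ γ′) ⟶* (δ ++ δ′)
  derive-++ {γ} {δ} {γ′} {δ′} p q =
    gmap (_++ γ′) (step-context [] γ′) p ◅◅
    subst₂ _⟶*_ (cong (δ ++_) (List.++-identityʳ γ′)) (cong (δ ++_) (List.++-identityʳ δ′))
      (gmap (λ μ → δ ++ μ ++ []) (step-context δ []) q)

  derive-concat : ∀ {a} {X : Set a} (f : X → Symbol) (g : X → List Symbol) →
                  (∀ x → (f x ∷ []) ⟶* g x) →
                  ∀ xs → List.map f xs ⟶* List.concat (List.map g xs)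
  derive-concat f g p []       = ε⋆
  derive-concat f g p (x ∷ xs) = derive-++ (p x) (derive-concat f g p xs)

-- The grammar and its encoding

-- bits y d + i is bit i of vector y, extended by 0 to y = n.  Letter 0 is the dummy and letter
-- 1 + y stands for vector y.  Row i < d lists the vectors with bit i set, padded with dummies to
-- length n + 1; row d is all dummies.  The start rule has the nonterminal of row i in place of
-- bit i of vector x if that bit is set, and that of row d otherwise.
module Encoding (n d σ : ℕ) {{_ : NonZero d}} (bits : ℕ → ℕ)
  (bits≤1 : ∀ a → bits a ≤ 1) (bits-end : ∀ a → n * d ≤ a → bits a ≡ 0) (n<σ : n < σ) where

  -- Products of bits replace case distinctions, in the shape of `rowEntry i (suc y)`, so that
  -- essentially only the addresses have to be compared.
  entry : ℕ → ℕ → ℕ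
  entry i y = bits (y * d + i) * toBit (i <ᵇ d) * suc y

  -- Vector `n` has no set bit by `bits-end`, so its place in every row holds the dummy and letter
  -- `n + 1` never arises.
  entry≤n : ∀ i {y} → y ≤ n → entry i y ≤ n
  entry≤n i {y} y≤n with m≤n⇒m<n∨m≡n y≤n
  ... | inj₁ y<n  = ≤-trans (*-monoˡ-≤ (suc y) (*-mono-≤ (bits≤1 (y * d + i)) (toBit≤1 (i <ᵇ d))))
                            (≤-trans (≤-reflexive (*-identityˡ (suc y))) y<n)
  ... | inj₂ refl = subst (_≤ n) (sym (cong (λ b → b * toBit (i <ᵇ d) * suc n) (bits-end (n * d + i) (m≤m+n _ i)))) z≤n

  letter : Fin (suc d) → Fin (suc n) → Fin σ
  letter i y = fromℕ< (≤-<-trans (entry≤n (toℕ i) (s≤s⁻¹ (toℕ<n y))) n<σ)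

  toℕ-letter : ∀ i y → toℕ (letter i y) ≡ entry (toℕ i) (toℕ y)
  toℕ-letter i y = toℕ-fromℕ< _

  row : Fin (suc d) → Vec (Fin σ) (suc n)
  row i = tabulate (letter i)

  selectedℕ : ℕ → ℕ
  selectedℕ j = d ∸ bits j * (d ∸ j % d)

  selected : Fin (n * d) → Fin (suc d)
  selected j = fromℕ< (s≤s (m∸n≤m d (bits (toℕ j) * (d ∸ toℕ j % d))))

  toℕ-selected : ∀ j → toℕ (selected j) ≡ selectedℕ (toℕ j)
  toℕ-selected j = toℕ-fromℕ< _

  text : Vec (Fin σ) (n * d * suc n)
  text = Vec.concat (Vec.map row (tabulate selected))

  rhs : Fin (2 + d) → List (Fin (2 + d) ⊎ Fin σ)
  rhs zero    = List.map (inj₁ ∘ suc) (toList (tabulate selected))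
  rhs (suc i) = List.map inj₂ (toList (row i))

  acyclic : ∀ {A B} → inj₁ B ∈ rhs A → toℕ A < toℕ B
  acyclic {zero} B∈ with ∈-map⁻ (inj₁ ∘ suc) B∈
  ... | _ , _ , refl = s≤s z≤n
  acyclic {suc i} B∈ with ∈-map⁻ inj₂ B∈
  ... | _ , _ , ()

  grammar : SLG σ
  grammar = record
    { v = 2 + d ; rhs = rhs ; start = zero ; order = Permutation.id ; acyclic = λ {A} {B} → acyclic {A} {B} }

  open SLG grammar using (size; code; Represents; rewriteAt; _⟶*_)

  -- One rewriting of the start symbol, after which the row nonterminals expand independently.
  represents : Represents text
  represents =
    subst ((inj₁ zero ∷ []) ⟶*_) (sym spelled)
      (rewriteAt [] zero [] ◅
       subst (_⟶* List.concat (List.map (List.map inj₂ ∘ toList ∘ row) js)) (sym (List.++-identityʳ (rhs zero)))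
         (derive-concat (inj₁ ∘ suc) (List.map inj₂ ∘ toList ∘ row) expand js))
    where
    open Derivations grammar
    js = toList (tabulate selected)
    expand : ∀ i → (inj₁ (suc i) ∷ []) ⟶* List.map inj₂ (toList (row i))
    expand i = subst ((inj₁ (suc i) ∷ []) ⟶*_) (List.++-identityʳ (rhs (suc i))) (rewriteAt [] (suc i) [] ◅ ε⋆)
    spelled : List.map inj₂ (toList text) ≡ List.concat (List.map (List.map inj₂ ∘ toList ∘ row) js)
    spelled = begin
      List.map inj₂ (toList text)
        ≡⟨ cong (List.map inj₂) (toList-concat (Vec.map row (tabulate selected))) ⟩
      List.map inj₂ (List.concat (List.map toList (toList (Vec.map row (tabulate selected)))))
        ≡⟨ List.concat-map (List.map toList (toList (Vec.map row (tabulate selected)))) ⟨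
      List.concat (List.map (List.map inj₂) (List.map toList (toList (Vec.map row (tabulate selected)))))
        ≡⟨ cong (λ xs → List.concat (List.map (List.map inj₂) (List.map toList xs))) (Vec.toList-map row (tabulate selected)) ⟩
      List.concat (List.map (List.map inj₂) (List.map toList (List.map row js)))
        ≡⟨ cong List.concat (trans (cong (List.map (List.map inj₂)) (sym (List.map-∘ js))) (sym (List.map-∘ js))) ⟩
      List.concat (List.map (List.map inj₂ ∘ toList ∘ row) js) ∎
      where open ≡-Reasoning

  length-rhs-start : length (rhs zero) ≡ n * d
  length-rhs-start = trans (List.length-map _ (toList (tabulate selected))) (Vec.length-toList (tabulate selected))

  length-rhs-row : ∀ i → length (rhs (suc i)) ≡ suc n
  length-rhs-row i = trans (List.length-map _ (toList (row i))) (Vec.length-toList (row i))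

  size≡ : size ≡ (n * d ⊔ 1) + suc d * suc n
  size≡ = cong₂ _+_ (cong (_⊔ 1) length-rhs-start)
    (sum-tabulate-const {suc d} (suc n) _ (λ i → trans (cong (_⊔ 1) (length-rhs-row i)) (m≥n⇒m⊔n≡m {suc n} (s≤s z≤n))))

  module Layout (w k : ℕ) (k≥1 : 1 ≤ k) (σ≡ : σ ≡ 2 ^ (k * d ∸ 1)) (kd< : k * d < 2 ^ w)
    (fits : σ + 2 * ((2 + n) * (2 + d)) < 2 ^ w) where

    open GrammarWriter w n d σ k bits bits≤1 k≥1 σ≡ kd< fits

    block : Fin (2 + d) → List ℕ
    block A = length (rhs A) ∷ List.map code (rhs A)

    blocks : List ℕ
    blocks = List.concatMap block (List.allFin (2 + d))

    rowBlocks : List ℕ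
    rowBlocks = List.concat (List.tabulate (block ∘ suc))

    blocks≡ : blocks ≡ block zero ++ rowBlocks
    blocks≡ = cong (λ xss → block zero ++ List.concat xss) (List.map-tabulate suc block)

    length-block : ∀ A {l} → length (rhs A) ≡ l → length (block A) ≡ suc l
    length-block A e = cong suc (trans (List.length-map code (rhs A)) e)

    length-rowBlocks : length rowBlocks ≡ rowsLength
    length-rowBlocks = length-concat-tabulate (block ∘ suc) (λ i → length-block (suc i) (length-rhs-row i))

    start-code : ∀ j → code (inj₁ (suc (selected j))) ≡ startCell (toℕ j)
    start-code j = begin
      suc (σ + suc (toℕ (selected j)))  ≡⟨ cong suc (+-suc σ _) ⟩
      2 + σ + toℕ (selected j)          ≡⟨ cong (2 + σ +_) (toℕ-selected j) ⟩
      2 + σ + selectedℕ (toℕ j)         ≡⟨ +-∸-assoc (2 + σ) prod≤d ⟨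
      startCell (toℕ j)                 ∎
      where
      open ≡-Reasoning
      prod≤d : bits (toℕ j) * (d ∸ toℕ j % d) ≤ d
      prod≤d = ≤-trans (*-mono-≤ (bits≤1 (toℕ j)) (m∸n≤m d (toℕ j % d))) (≤-reflexive (*-identityˡ d))

    cells-map : ∀ {m} {X : Set} (f : X → SLG.Symbol grammar) (xs : Vec X m) i →
                cells w (List.map code (List.map f (toList xs))) (toℕ i) ≡ toWord w (code (f (lookup xs i)))
    cells-map f xs i = begin
      cells w (List.map code (List.map f (toList xs))) (toℕ i)
        ≡⟨ cong (λ l → cells w l (toℕ i)) (trans (sym (List.map-∘ (toList xs))) (sym (Vec.toList-map (code ∘ f) xs))) ⟩
      cells w (toList (Vec.map (code ∘ f) xs)) (toℕ i)
        ≡⟨ cells-toList w (Vec.map (code ∘ f) xs) i ⟩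
      toWord w (lookup (Vec.map (code ∘ f) xs) i)
        ≡⟨ cong (toWord w) (Vec.lookup-map i (code ∘ f) xs) ⟩
      toWord w (code (f (lookup xs i))) ∎
      where open ≡-Reasoning

    cells-start : ∀ {j} → j < n * d → cells w (block zero) (suc j) ≡ startCell j
    cells-start {j} j< = begin
      cells w (List.map code (rhs zero)) j
        ≡⟨ cong (cells w (List.map code (rhs zero))) (toℕ-fromℕ< j<) ⟨
      cells w (List.map code (rhs zero)) (toℕ j′)
        ≡⟨ cells-map (inj₁ ∘ suc) (tabulate selected) j′ ⟩
      toWord w (code (inj₁ (suc (lookup (tabulate selected) j′))))
        ≡⟨ cong (λ i → toWord w (code (inj₁ (suc i)))) (Vec.lookup∘tabulate selected j′) ⟩
      toWord w (code (inj₁ (suc (selected j′))))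
        ≡⟨ cong (toWord w) (trans (start-code j′) (cong startCell (toℕ-fromℕ< j<))) ⟩
      toWord w (startCell j)
        ≡⟨ toWord-small w (≤-<-trans (m∸n≤m (2 + σ + d) (bits j * (d ∸ j % d))) code<) ⟩
      startCell j ∎
      where
      open ≡-Reasoning
      j′ = fromℕ< j<

    cells-row : ∀ i {p} → p < 2 + n → cells w (block (suc i)) p ≡ suc (rowEntry (toℕ i) p)
    cells-row i {zero} p< = begin
      toWord w (length (rhs (suc i)))   ≡⟨ cong (toWord w) (length-rhs-row i) ⟩
      toWord w (suc n)                  ≡⟨ toWord-small w n+1<2^w ⟩
      suc n                             ≡⟨ cong suc (+-identityʳ n) ⟨
      suc (0 + 1 * n)                   ≡⟨ cong (λ x → suc (x + 1 * n)) (*-zeroʳ (bits (toℕ i ∸ d) * toBit (toℕ i <ᵇ d))) ⟨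
      suc (rowEntry (toℕ i) 0)          ∎
      where open ≡-Reasoning
    cells-row i {suc y} p< = begin
      cells w (List.map code (rhs (suc i))) y
        ≡⟨ cong (cells w (List.map code (rhs (suc i)))) (toℕ-fromℕ< y<) ⟨
      cells w (List.map code (rhs (suc i))) (toℕ y′)
        ≡⟨ cells-map inj₂ (row i) y′ ⟩
      toWord w (suc (toℕ (lookup (row i) y′)))
        ≡⟨ cong (λ a → toWord w (suc a)) (trans (cong toℕ (Vec.lookup∘tabulate (letter i) y′))
             (trans (toℕ-letter i y′) (cong (entry (toℕ i)) (toℕ-fromℕ< y<)))) ⟩
      toWord w (suc (entry (toℕ i) y))
        ≡⟨ toWord-small w (≤-<-trans (s≤s (entry≤n (toℕ i) (s≤s⁻¹ y<))) n+1<2^w) ⟩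
      suc (entry (toℕ i) y)
        ≡⟨ cong (λ a → suc (bits a * toBit (toℕ i <ᵇ d) * suc y)) address ⟨
      suc (bits (suc y * d + toℕ i ∸ d) * toBit (toℕ i <ᵇ d) * suc y)
        ≡⟨ cong suc (+-identityʳ _) ⟨
      suc (rowEntry (toℕ i) (suc y)) ∎
      where
      open ≡-Reasoning
      y< : y < suc n
      y< = s≤s⁻¹ p<
      y′ = fromℕ< y<
      address : suc y * d + toℕ i ∸ d ≡ y * d + toℕ i
      address = trans (cong (_∸ d) (+-assoc d (y * d) (toℕ i))) (m+n∸m≡n d _)

    -- Needed at every address, since the builder may rely on zeros beyond its input. The encoded
    -- grammar is longer than the encoded vectors, so no bit survives behind it.
    written-is-input : ∀ {m} → Written-Grammar m → ∀ a → cells w blocks a ≡ m a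
    written-is-input {m} W a = trans (cong (λ l → cells w l a) blocks≡) (at a)
      where
      open Written-Grammar W
      length-start : length (block zero) ≡ suc (n * d)
      length-start = length-block zero length-rhs-start
      in-start : ∀ {b} → b < suc (n * d) → cells w (block zero ++ rowBlocks) b ≡ cells w (block zero) b
      in-start {b} b< = cells-++ˡ w (block zero) rowBlocks (subst (b <_) (sym length-start) b<)
      in-rows : ∀ b → cells w (block zero ++ rowBlocks) (suc (n * d) + b) ≡ cells w rowBlocks b
      in-rows b = trans (cong (λ l → cells w (block zero ++ rowBlocks) (l + b)) (sym length-start))
                        (cells-++ʳ w (block zero) rowBlocks b)
      rows : ∀ b → cells w rowBlocks b ≡ m (suc (n * d) + b)
      rows b with b <? rowsLength
      ... | yes b< = begin
        cells w rowBlocks b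
          ≡⟨ cong (cells w rowBlocks) split ⟩
        cells w rowBlocks (toℕ i * (2 + n) + b % (2 + n))
          ≡⟨ cells-concat w (block ∘ suc) (λ i → length-block (suc i) (length-rhs-row i)) i (m%n<n b (2 + n)) ⟩
        cells w (block (suc i)) (b % (2 + n))
          ≡⟨ cells-row i (m%n<n b (2 + n)) ⟩
        suc (rowEntry (toℕ i) (b % (2 + n)))
          ≡⟨ cong (λ q → suc (rowEntry q (b % (2 + n)))) (toℕ-fromℕ< quot<) ⟩
        rowCell b
          ≡⟨ row-cells b b< ⟨
        m (suc (n * d) + b) ∎
        where
        open ≡-Reasoning
        quot< : b / (2 + n) < suc d
        quot< = m<n*o⇒m/o<n b<
        i = fromℕ< quot<
        split : b ≡ toℕ i * (2 + n) + b % (2 + n)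
        split = trans (m≡m%n+[m/n]*n b (2 + n))
          (trans (+-comm (b % (2 + n)) _) (cong (λ q → q * (2 + n) + b % (2 + n)) (sym (toℕ-fromℕ< quot<))))
      ... | no b≮ = let b≥ = ≮⇒≥ b≮ in trans
        (cells-beyond w rowBlocks (subst (_≤ b) (sym length-rowBlocks) b≥))
        (sym (trans (rest _ (+-monoʳ-≤ (suc (n * d)) b≥))
                    (bits-end _ (≤-trans (n≤1+n _) (m≤m+n (suc (n * d)) b)))))
      at : ∀ b → cells w (block zero ++ rowBlocks) b ≡ m b
      at b with b <? suc (n * d)
      at zero    | yes b< = trans (in-start b<)
        (trans (cong (toWord w) length-rhs-start) (trans (toWord-small w (≤2Z nd≤2Z)) (sym start-length)))
      at (suc j) | yes b< = trans (in-start b<) (trans (cells-start (s≤s⁻¹ b<)) (sym (start-cells j (s≤s⁻¹ b<))))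
      at b       | no b≮  = subst (λ c → cells w (block zero ++ rowBlocks) c ≡ m c)
        (m+[n∸m]≡n (≮⇒≥ b≮)) (trans (in-rows _) (rows _))

-- Distinct letters of a block

does-true : ∀ {a} {P : Set a} (P? : Dec P) → does P? ≡ true → P
does-true (yes p) _ = p

module _ {σ N} (T : Vec (Fin σ) N) (b e : ℕ) where

  Occurs : Fin σ → Set
  Occurs a = ∃[ i ] b < suc (toℕ i) × suc (toℕ i) ≤ e × lookup T i ≡ a

  ∈-symbolsIn⁺ : ∀ {a} → Occurs a → a ∈ₛ symbolsIn T b e
  ∈-symbolsIn⁺ {a} occ = Vec.lookup⇒[]= a (symbolsIn T b e)
    (trans (Vec.lookup∘tabulate _ a) (dec-true (any? _) occ))

  ∈-symbolsIn⁻ : ∀ {a} → a ∈ₛ symbolsIn T b e → Occurs a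
  ∈-symbolsIn⁻ {a} a∈ = does-true (any? _)
    (trans (sym (Vec.lookup∘tabulate _ a)) (Vec.[]=⇒lookup a∈))

-- A set of known size: the symbols of a block are counted by comparing them, by inclusion, with
-- `segment σ (suc n)`.
segment : ∀ σ → ℕ → Subset σ
segment σ m = tabulate (λ a → toℕ a <ᵇ m)

∣segment∣ : ∀ σ {m} → m ≤ σ → ∣ segment σ m ∣ ≡ m
∣segment∣ zero    {zero}  _    = refl
∣segment∣ (suc σ) {zero}  _    = ∣segment∣ σ z≤n
∣segment∣ (suc σ) {suc m} m≤σ  = cong suc (∣segment∣ σ (s≤s⁻¹ m≤σ))

∈-segment⁺ : ∀ {σ m} {a : Fin σ} → toℕ a < m → a ∈ₛ segment σ m
∈-segment⁺ {σ} {m} {a} a<m = Vec.lookup⇒[]= a (segment σ m)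
  (trans (Vec.lookup∘tabulate _ a) (dec-true (toℕ a <? m) a<m))

∈-segment⁻ : ∀ {σ m} {a : Fin σ} → a ∈ₛ segment σ m → toℕ a < m
∈-segment⁻ {σ} {m} {a} a∈ = does-true (toℕ a <? m)
  (trans (sym (Vec.lookup∘tabulate _ a)) (Vec.[]=⇒lookup a∈))

<⇒<ᵇ-true : ∀ {m n} → m < n → (m <ᵇ n) ≡ true
<⇒<ᵇ-true {m} {n} m<n = dec-true (m <? n) m<n

bit-cases : ∀ {b} → b ≤ 1 → b ≡ 0 ⊎ b ≡ 1
bit-cases z≤n       = inj₁ refl
bit-cases (s≤s z≤n) = inj₂ refl

module Counting (n d σ : ℕ) {{_ : NonZero d}} (bits : ℕ → ℕ)
  (bits≤1 : ∀ a → bits a ≤ 1) (bits-end : ∀ a → n * d ≤ a → bits a ≡ 0) (n<σ : n < σ) where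

  open Encoding n d σ bits bits≤1 bits-end n<σ

  Meet : ℕ → ℕ → Set
  Meet x y = ∃[ i ] i < d × bits (x * d + i) ≡ 1 × bits (y * d + i) ≡ 1

  -- The length of a block: `d` lists of `n + 1` letters each.
  stride : ℕ
  stride = n * d + d

  position : Fin n → Fin d → Fin (suc n) → Fin (n * d * suc n)
  position x i y = combine (combine x i) y

  lookup-text : ∀ x i y → toℕ (lookup text (position x i y)) ≡
                entry (selectedℕ (toℕ x * d + toℕ i)) (toℕ y)
  lookup-text x i y = begin
    toℕ (lookup text (position x i y))
      ≡⟨ cong toℕ (Vec.lookup-concat (Vec.map row (tabulate selected)) (combine x i) y) ⟩
    toℕ (lookup (lookup (Vec.map row (tabulate selected)) (combine x i)) y)
      ≡⟨ cong (λ r → toℕ (lookup r y)) (trans (Vec.lookup-map (combine x i) row (tabulate selected))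
           (cong row (Vec.lookup∘tabulate selected (combine x i)))) ⟩
    toℕ (lookup (row (selected (combine x i))) y)
      ≡⟨ cong toℕ (Vec.lookup∘tabulate (letter (selected (combine x i))) y) ⟩
    toℕ (letter (selected (combine x i)) y)
      ≡⟨ toℕ-letter (selected (combine x i)) y ⟩
    entry (toℕ (selected (combine x i))) (toℕ y)
      ≡⟨ cong (λ j → entry j (toℕ y)) (trans (toℕ-selected (combine x i))
           (cong selectedℕ (trans (toℕ-combine x i) (cong (_+ toℕ i) (*-comm d (toℕ x)))))) ⟩
    entry (selectedℕ (toℕ x * d + toℕ i)) (toℕ y) ∎
    where open ≡-Reasoning

  selected-1 : ∀ x {i} → i < d → bits (x * d + i) ≡ 1 → selectedℕ (x * d + i) ≡ i
  selected-1 x {i} i<d b≡1 = begin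
    d ∸ bits (x * d + i) * (d ∸ (x * d + i) % d)
      ≡⟨ cong₂ (λ b r → d ∸ b * (d ∸ r)) b≡1
           (trans (cong (_% d) (+-comm (x * d) i)) (trans ([m+kn]%n≡m%n i x d) (m<n⇒m%n≡m i<d))) ⟩
    d ∸ (d ∸ i + 0)
      ≡⟨ cong (d ∸_) (+-identityʳ (d ∸ i)) ⟩
    d ∸ (d ∸ i)
      ≡⟨ m∸[m∸n]≡n (<⇒≤ i<d) ⟩
    i ∎
    where open ≡-Reasoning

  entry-1 : ∀ {i} y → i < d → bits (y * d + i) ≡ 1 → entry i y ≡ suc y
  entry-1 {i} y i<d b≡1 = trans
    (cong₂ (λ b c → b * toBit c * suc y) b≡1 (<⇒<ᵇ-true i<d)) (*-identityˡ (suc y))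

  -- Padding produces letter 0 only, so a positive letter identifies its vector and certifies the
  -- bit.
  entry-suc : ∀ i y z → entry i y ≡ suc z → y ≡ z × i < d × bits (y * d + i) ≡ 1
  entry-suc i y z e with bit-cases (bits≤1 (y * d + i)) | i <? d
  ... | inj₁ b≡0 | _ = contradiction (trans (sym e) (cong (λ b → b * toBit (i <ᵇ d) * suc y) b≡0)) 1+n≢0
  ... | inj₂ b≡1 | yes i<d = suc-injective (trans (sym (entry-1 y i<d b≡1)) e) , i<d , b≡1
  ... | inj₂ b≡1 | no i≮d = contradiction (trans (sym e) zero-entry) 1+n≢0
    where
    zero-entry : entry i y ≡ 0
    zero-entry = begin
      bits (y * d + i) * toBit (does (i <? d)) * suc y  ≡⟨ cong (λ c → bits (y * d + i) * toBit c * suc y) (dec-false (i <? d) i≮d) ⟩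
      bits (y * d + i) * 0 * suc y        ≡⟨ cong (_* suc y) (*-zeroʳ (bits (y * d + i))) ⟩
      0 ∎
      where open ≡-Reasoning

  meets : ∀ x i y {z} → i < d → entry (selectedℕ (x * d + i)) y ≡ suc z → y ≡ z × Meet x z
  meets x i y {z} i<d e with bit-cases (bits≤1 (x * d + i))
  -- An unset bit selects row `d`, whereas a positive letter requires a row below `d`.
  ... | inj₁ b≡0 = contradiction (proj₁ (proj₂ (entry-suc _ y z e)))
                     (≤⇒≯ (≤-reflexive (sym (cong (λ b → d ∸ b * (d ∸ (x * d + i) % d)) b≡0))))
  ... | inj₂ b≡1 with refl , _ , c ← entry-suc i y z (trans (cong (λ j → entry j y) (sym (selected-1 x i<d b≡1))) e)
      = refl , i , i<d , b≡1 , c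

  toℕ-position : ∀ x i y → toℕ (position x i y) ≡ toℕ x * stride + (suc n * toℕ i + toℕ y)
  toℕ-position x i y = begin
    toℕ (position x i y)                                ≡⟨ toℕ-combine (combine x i) y ⟩
    suc n * toℕ (combine x i) + toℕ y                   ≡⟨ cong (λ j → suc n * j + toℕ y) (toℕ-combine x i) ⟩
    suc n * (d * toℕ x + toℕ i) + toℕ y                 ≡⟨ e n d (toℕ x) (toℕ i) (toℕ y) ⟩
    toℕ x * stride + (suc n * toℕ i + toℕ y)            ∎
    where
    open ≡-Reasoning
    e : ∀ n d x i y → suc n * (d * x + i) + y ≡ x * (n * d + d) + (suc n * i + y)
    e = solve-∀

  offset<stride : ∀ (i : Fin d) (y : Fin (suc n)) → suc n * toℕ i + toℕ y < stride
  offset<stride i y = begin-strict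
    suc n * toℕ i + toℕ y    <⟨ +-monoʳ-< (suc n * toℕ i) (toℕ<n y) ⟩
    suc n * toℕ i + suc n    ≡⟨ trans (+-comm (suc n * toℕ i) (suc n)) (sym (*-suc (suc n) (toℕ i))) ⟩
    suc n * suc (toℕ i)      ≤⟨ *-monoʳ-≤ (suc n) (toℕ<n i) ⟩
    suc n * d                ≡⟨ +-comm d (n * d) ⟩
    stride                   ∎
    where open ≤-Reasoning

  -- Uniqueness of the quotient by `stride`: the range queried for vector `x` meets no other block.
  same-block : ∀ {x x′ r} → r < stride → x * stride ≤ x′ * stride + r →
               x′ * stride + r < x * stride + stride → x′ ≡ x
  same-block {x} {x′} {r} r< lo hi = ≤-antisym
    (s≤s⁻¹ (*-cancelʳ-< stride x′ (suc x) (≤-<-trans (m≤m+n _ r) (<-≤-trans hi (≤-reflexive (+-comm _ stride))))))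
    (s≤s⁻¹ (*-cancelʳ-< stride x (suc x′) (≤-<-trans lo (<-≤-trans (+-monoʳ-< (x′ * stride) r<) (≤-reflexive (+-comm _ stride))))))

  module _ (x : Fin n) where

    private
      b = toℕ x * stride
      e = b + stride

    occurs : ∀ i y {a} → toℕ a ≡ entry (selectedℕ (toℕ x * d + toℕ i)) (toℕ y) → a ∈ₛ symbolsIn text b e
    occurs i y {a} a≡ = ∈-symbolsIn⁺ text b e
      ( position x i y
      , s≤s (subst (b ≤_) (sym (toℕ-position x i y)) (m≤m+n b _))
      , subst (_< e) (sym (toℕ-position x i y)) (+-monoʳ-< b (offset<stride i y))
      , toℕ-injective (trans (lookup-text x i y) (sym a≡)))

    occurring : ∀ {a} → a ∈ₛ symbolsIn text b e →
                ∃[ i ] ∃[ y ] toℕ a ≡ entry (selectedℕ (toℕ x * d + toℕ i)) (toℕ y)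
    occurring {a} a∈ = from (∈-symbolsIn⁻ text b e a∈)
      where
      from : Occurs text b e a → ∃[ i ] ∃[ y ] toℕ a ≡ entry (selectedℕ (toℕ x * d + toℕ i)) (toℕ y)
      from (p , b< , ≤e , T≡a)
        with xi , y , refl ← combine-surjective {n * d} {suc n} p
        with x′ , i , refl ← combine-surjective {n} {d} xi
        with refl ← toℕ-injective (same-block {toℕ x} {toℕ x′} (offset<stride i y)
               (subst (b ≤_) (toℕ-position x′ i y) (s≤s⁻¹ b<))
               (subst (_< e) (toℕ-position x′ i y) ≤e))
        = i , y , trans (cong toℕ (sym T≡a)) (lookup-text x i y)

    distinct-full : (∀ y → y < n → Meet (toℕ x) y) → n < distinct text b e
    distinct-full all = subst (_≤ distinct text b e) (∣segment∣ σ n<σ)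
      (p⊆q⇒∣p∣≤∣q∣ (λ a∈ → member _ refl (s≤s⁻¹ (∈-segment⁻ a∈))))
      where
      member : ∀ {a} m → toℕ a ≡ m → m ≤ n → a ∈ₛ symbolsIn text b e
      -- The dummy is found at list position `n`, which belongs to no vector. Any of the `d` lists
      -- would do; this is the first.
      member zero a≡ _ = occurs (fromℕ< {0} (>-nonZero⁻¹ d)) (fromℕ n)
        (trans a≡ (sym (trans (cong (entry i′) (toℕ-fromℕ n))
          (cong (λ c → c * toBit (i′ <ᵇ d) * suc n) (bits-end (n * d + i′) (m≤m+n _ i′))))))
        where i′ = selectedℕ (toℕ x * d + toℕ (fromℕ< {0} (>-nonZero⁻¹ d)))
      member (suc y) a≡ y<n with i , i<d , bx , by ← all y y<n =
        occurs (fromℕ< i<d) (fromℕ< (m≤n⇒m≤1+n y<n))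
          (trans a≡ (sym (trans (cong₂ (λ j z → entry (selectedℕ (toℕ x * d + j)) z) (toℕ-fromℕ< i<d) (toℕ-fromℕ< (m≤n⇒m≤1+n y<n)))
            (trans (cong (λ j → entry j y) (selected-1 (toℕ x) i<d bx)) (entry-1 y i<d by)))))

    -- The symbols lie in the segment of size `n + 1`, and letter `1 + y` is missing, because an
    -- occurrence would exhibit a common one of `x` and `y`.
    distinct-partial : ∀ {y} → y < n → ¬ Meet (toℕ x) y → distinct text b e ≤ n
    distinct-partial {y} y<n apart = s≤s⁻¹ (subst (distinct text b e <_) (∣segment∣ σ n<σ)
      (p⊂q⇒∣p∣<∣q∣ (bounded , missing , ∈-segment⁺ (subst (_< suc n) (sym missing≡) (s≤s y<n)) , absent)))
      where
      missing : Fin σ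
      missing = fromℕ< (≤-<-trans y<n n<σ)
      missing≡ : toℕ missing ≡ suc y
      missing≡ = toℕ-fromℕ< _
      bounded : ∀ {a} → a ∈ₛ symbolsIn text b e → a ∈ₛ segment σ (suc n)
      bounded a∈ with i , z , a≡ ← occurring a∈ =
        ∈-segment⁺ (s≤s (subst (_≤ n) (sym a≡) (entry≤n _ (s≤s⁻¹ (toℕ<n z)))))
      absent : ¬ missing ∈ₛ symbolsIn text b e
      absent a∈ with i , z , a≡ ← occurring a∈ =
        apart (proj₂ (meets (toℕ x) (toℕ i) (toℕ z) (toℕ<n i) (trans (sym a≡) missing≡)))

-- Inner products and stored bits

common-one : ∀ {d} (x y : BitVec d) → inner x y ≢ 0 →
             ∃[ i ] toℕ (lookup x i) ≡ 1 × toℕ (lookup y i) ≡ 1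
common-one []             []             ne = contradiction refl ne
common-one (suc zero ∷ x) (suc zero ∷ y) ne = zero , refl , refl
common-one (suc zero ∷ x) (zero ∷ y)     ne = let i , p , q = common-one x y ne in suc i , p , q
common-one (zero ∷ x)     (_ ∷ y)        ne = let i , p , q = common-one x y ne in suc i , p , q

common-one⇒inner≢0 : ∀ {d} (x y : BitVec d) i → toℕ (lookup x i) ≡ 1 → toℕ (lookup y i) ≡ 1 →
                     inner x y ≢ 0
common-one⇒inner≢0 (suc zero ∷ x) (suc zero ∷ y) zero    p q = 1+n≢0
common-one⇒inner≢0 (a ∷ x) (b ∷ y) (suc i) p q e =
  common-one⇒inner≢0 x y i p q (m+n≡0⇒n≡0 (toℕ a * toℕ b) e)

cells≤1 : ∀ w {m} (xs : Vec (Fin 2) m) a → cells w (toList (Vec.map toℕ xs)) a ≤ 1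
cells≤1 w []       a       = z≤n
cells≤1 w (x ∷ xs) zero    = ≤-trans (m%n≤m (toℕ x) (2 ^ w) {{m^n≢0 2 w}}) (s≤s⁻¹ (toℕ<n x))
cells≤1 w (x ∷ xs) (suc a) = cells≤1 w xs a

module OVBits (w : ℕ) (1<2^w : 1 < 2 ^ w) {n d} (A : Vec (BitVec d) n) where

  bits : ℕ → ℕ
  bits = mem (ovInput w A)

  bits≤1 : ∀ a → bits a ≤ 1
  bits≤1 = cells≤1 w (Vec.concat A)

  bits-end : ∀ a → n * d ≤ a → bits a ≡ 0
  bits-end a le = cells-beyond w (toList (Vec.map toℕ (Vec.concat A)))
    (subst (_≤ a) (sym (Vec.length-toList (Vec.map toℕ (Vec.concat A)))) le)

  bit-at : ∀ x i → bits (toℕ x * d + toℕ i) ≡ toℕ (lookup (lookup A x) i)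
  bit-at x i = begin
    bits (toℕ x * d + toℕ i)
      ≡⟨ cong bits (trans (toℕ-combine x i) (cong (_+ toℕ i) (*-comm d (toℕ x)))) ⟨
    bits (toℕ (combine x i))
      ≡⟨ cells-toList w (Vec.map toℕ (Vec.concat A)) (combine x i) ⟩
    toWord w (lookup (Vec.map toℕ (Vec.concat A)) (combine x i))
      ≡⟨ cong (toWord w) (trans (Vec.lookup-map (combine x i) toℕ (Vec.concat A))
           (cong toℕ (Vec.lookup-concat A x i))) ⟩
    toWord w (toℕ (lookup (lookup A x) i))
      ≡⟨ toWord-small w (≤-<-trans (s≤s⁻¹ (toℕ<n (lookup (lookup A x) i))) 1<2^w) ⟩
    toℕ (lookup (lookup A x) i) ∎
    where open ≡-Reasoning

  module _ {{_ : NonZero d}} {σ} (n<σ : n < σ) where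

    open Counting n d σ bits bits≤1 bits-end n<σ using (Meet)

    orthogonal⇒apart : ∀ x y → inner (lookup A x) (lookup A y) ≡ 0 → ¬ Meet (toℕ x) (toℕ y)
    orthogonal⇒apart x y orth (i , i<d , bx , by) =
      common-one⇒inner≢0 (lookup A x) (lookup A y) (fromℕ< i<d) (at x bx) (at y by) orth
      where
      at : ∀ z → bits (toℕ z * d + i) ≡ 1 → toℕ (lookup (lookup A z) (fromℕ< i<d)) ≡ 1
      at z b≡1 = trans (sym (bit-at z (fromℕ< i<d)))
        (trans (cong (λ j → bits (toℕ z * d + j)) (toℕ-fromℕ< i<d)) b≡1)

    nonorthogonal⇒meet : ∀ x y → inner (lookup A x) (lookup A y) ≢ 0 → Meet (toℕ x) (toℕ y)
    nonorthogonal⇒meet x y ne with i , p , q ← common-one (lookup A x) (lookup A y) ne =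
      toℕ i , toℕ<n i , trans (bit-at x i) p , trans (bit-at y i) q

-- The loop of queries

module _ (threshold : ℕ) (count : ℕ → ℕ) where

  -- Counting all hits, instead of stopping at the first, leaves the loop a plain countdown; the
  -- output only asks whether the total is positive.
  hits : ℕ → ℕ
  hits zero    = 0
  hits (suc x) = hits x + toBit (count x <ᵇ threshold)

  hits≤ : ∀ x → hits x ≤ x
  hits≤ zero    = z≤n
  hits≤ (suc x) = ≤-trans (+-mono-≤ (hits≤ x) (toBit≤1 (count x <ᵇ threshold))) (≤-reflexive (+-comm x 1))

  hit⇒positive : ∀ {x m} → x < m → count x < threshold → 0 < hits m
  hit⇒positive {x} {suc m} x<1+m hit with m≤n⇒m<n∨m≡n (s≤s⁻¹ x<1+m)
  ... | inj₁ x<m  = ≤-trans (hit⇒positive x<m hit) (m≤m+n _ _)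
  ... | inj₂ refl = ≤-trans (≤-reflexive (sym (cong toBit (<⇒<ᵇ-true hit)))) (m≤n+m _ (hits x))

  positive⇒hit : ∀ m → 0 < hits m → ∃[ x ] x < m × count x < threshold
  positive⇒hit (suc m) pos with count m <? threshold
  ... | yes hit = m , ≤-refl , hit
  ... | no  ¬hit =
    let x , x<m , hit = positive⇒hit m (subst (0 <_)
          (trans (cong (λ b → hits m + toBit b) (dec-false (count m <? threshold) ¬hit)) (+-identityʳ _)) pos)
    in x , m<n⇒m<1+n x<m , hit

-- Register 8 is the left end of the current block. Advanced by the stride it is the right end, and
-- at once the left end for the next iteration. Registers 16 and 17 carry the arguments of the
-- relocated query, and 16 then its answer.
ask : ℕ → Program → Program
ask B query =
  clear B ⨾ move 16 8 ⨾ op add 8 8 10 ⨾ move 17 8 ⨾ shift query ⨾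
  op lt 12 16 11 ⨾ op add 9 9 12 ⨾ op sub 7 7 2

module QueryLoop
  (w B n stride N : ℕ) (N≡ : n * stride ≡ N) (query : Program) (B≥ : regBound query ≤ B) (B≥2 : 2 ≤ B)
  (M₀ : ℕ → ℕ) (count : ℕ → ℕ) (N< : N < 2 ^ w) (n+1< : 1 + n < 2 ^ w) (Q : ℕ → Set) (Q0 : Q 0)
  (answers : ∀ {M} → Reachable w query N M₀ M → ∀ x → x < n →
     ∃[ t ] ∃[ s ] (w ⊢ query , queryInput w (x * stride) (x * stride + stride) M ⇓[ t ] s) ×
       regs s 0 ≡ count x × Q t)
  where

  -- `M` is the memory of the unrelocated runs, to which `answers` applies; the actual memory agrees
  -- with it pointwise. `high` is why clearing `B` registers suffices.
  record LoopInv (k : ℕ) (s : State) : Set where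
    constructor inv
    field
      k≤n  : k ≤ n
      r2   : regs s 2 ≡ 1
      r7   : regs s 7 ≡ k
      r8   : regs s 8 ≡ (n ∸ k) * stride
      r9   : regs s 9 ≡ hits (1 + n) count (n ∸ k)
      r10  : regs s 10 ≡ stride
      r11  : regs s 11 ≡ 1 + n
      r13  : regs s 13 ≡ 0
      high : ∀ r → B ≤ r → regs s (16 + r) ≡ 0
      {M}  : ℕ → ℕ
      reachable : Reachable w query N M₀ M
      memory    : ∀ a → M a ≡ mem s a
  open LoopInv

  -- The query is accompanied by `B + 1` steps of clearing and six further instructions.
  BodyCost : ℕ → Set
  BodyCost t = ∃[ t′ ] Q t′ × t ≤ t′ + (B + 7)

  loop-step : ∀ {k s} → LoopInv (suc k) s →
              ∃[ t ] ∃[ s′ ] (w ⊢ ask B query , s ⇓[ t ] s′) × LoopInv k s′ × BodyCost t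
  loop-step {k} {s} I = after-clear (clear-run w B s)
    where
    Goal : Set
    Goal = ∃[ t ] ∃[ s′ ] (w ⊢ ask B query , s ⇓[ t ] s′) × LoopInv k s′ × BodyCost t
    x = n ∸ suc k
    x<n : x < n
    x<n = ∸-monoʳ-< {n} {suc k} {0} (s≤s z≤n) (k≤n I)
    next : n ∸ k ≡ suc x
    next = trans (+-∸-assoc 1 (k≤n I)) refl
    b = x * stride
    e = b + stride
    e≤N : e ≤ N
    e≤N = ≤-trans (≤-reflexive (+-comm b stride)) (≤-trans (*-monoˡ-≤ stride x<n) (≤-reflexive N≡))
    b≤N : b ≤ N
    b≤N = ≤-trans (m≤m+n b stride) e≤N
    after-clear : ∃[ s₁ ] (w ⊢ clear B , s ⇓[ suc B ] s₁) × Cleared B s s₁ → Goal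
    after-clear (⟨ f₁ , m₁ ⟩ , run₁ , C) = after-query (answers (reachable I) x x<n)
      where
      kept : ∀ r → T (r <ᵇ 16) → f₁ r ≡ regs s r
      kept r r< = low C r (<ᵇ⇒< r 16 r<)
      zeroed : ∀ r → f₁ (16 + r) ≡ 0
      zeroed r with r <? B
      ... | yes r<B = zeros C r r<B
      ... | no  r≮B = trans (high C r (≮⇒≥ r≮B)) (high I r (≮⇒≥ r≮B))
      s₂ : State
      s₂ = ⟨ ((f₁ [ 16 ↦ b ]) [ 8 ↦ e ]) [ 17 ↦ e ] , m₁ ⟩
      input∼ : queryInput w b e (M I) ∼ s₂
      input∼ = agree
        (λ { zero → toWord-small w (≤-<-trans b≤N N<)
           ; (suc zero) → toWord-small w (≤-<-trans e≤N N<)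
           ; (suc (suc r)) → sym (zeroed (2 + r)) })
        (λ a → trans (memory I a) (cong (λ m → m a) (sym (same C))))
      after-query :
        ∃[ t ] ∃[ s′ ] (w ⊢ query , queryInput w b e (M I) ⇓[ t ] s′) × regs s′ 0 ≡ count x × Q t → Goal
      after-query (t , s′ , run , answer , q) = after-simulation (simulate run input∼)
        where
        after-simulation : ∃[ s₃ ] (w ⊢ shift query , s₂ ⇓[ t ] s₃) × s′ ∼ s₃ × LowRegsKept s₂ s₃ → Goal
        after-simulation (⟨ f₃ , m₃ ⟩ , run₃ , agree R M , keep) = _ , _ ,
          (run₁ ⨾ move-run 16 (trans (kept 8 _) (r8 I)) ⨾
           add-run e 8 (trans (kept 8 _) (r8 I)) (trans (kept 10 _) (r10 I)) refl (≤-<-trans e≤N N<) ⨾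
           move-run 17 refl ⨾
           run₃ ⨾
           lt-run {x = count x} {1 + n} 12 (trans (sym (R 0)) answer) (trans (keep′ 11 _) (trans (kept 11 _) (r11 I))) 1< ⨾
           add-run (hits (1 + n) count (suc x)) 9 (trans (keep′ 9 _) (trans (kept 9 _) (r9 I))) refl refl
             (≤-<-trans (≤-trans (hits≤ (1 + n) count (suc x)) x<n) (<-trans (n<1+n n) n+1<)) ⨾
           sub-run k 7 (trans (keep′ 7 _) (trans (kept 7 _) (r7 I))) (trans (keep′ 2 _) (trans (kept 2 _) (r2 I)))
             refl (s≤s z≤n) (≤-<-trans (k≤n I) (<-trans (n<1+n n) n+1<))) ,
          inv (<⇒≤ (k≤n I))
              (trans (keep′ 2 _) (trans (kept 2 _) (r2 I)))
              refl
              (trans (keep′ 8 _) (trans (+-comm b stride) (cong (_* stride) (sym next))))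
              (cong (hits (1 + n) count) (sym next))
              (trans (keep′ 10 _) (trans (kept 10 _) (r10 I)))
              (trans (keep′ 11 _) (trans (kept 11 _) (r11 I)))
              (trans (keep′ 13 _) (trans (kept 13 _) (r13 I)))
              (λ r B≤r → trans (sym (R r)) (trans (untouched run r (≤-trans B≥ B≤r)) (blank r (≤-trans B≥2 B≤r))))
              -- A query may alter the memory, so the guarantee for the next one rests on
              -- reachability.
              (queried (reachable I) b≤N e≤N run)
              M ,
          t , q , ≤-reflexive (time B t)
          where
          keep′ : ∀ r → T (r <ᵇ 16) → f₃ r ≡ regs s₂ r
          keep′ r r< = keep r (<ᵇ⇒< r 16 r<)
          1< : 1 < 2 ^ w
          1< = ≤-<-trans (s≤s z≤n) n+1<
          blank : ∀ r → 2 ≤ r → cells w (b ∷ e ∷ []) r ≡ 0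
          blank (suc zero) (s≤s ())
          blank (suc (suc r)) _ = refl
          time : ∀ B t → suc B + (1 + (1 + (1 + (t + (1 + (1 + 1)))))) ≡ t + (B + 7)
          time = solve-∀

  query-loop : ∀ {s} → LoopInv n s →
    ∃[ t ] ∃[ s′ ] (w ⊢ whileNonzero 7 (ask B query) , s ⇓[ t ] s′) × LoopInv 0 s′ ×
      ∃[ u ] BodyCost u × t ≤ suc (n * suc u)
  query-loop = countdown LoopInv BodyCost (0 , Q0 , z≤n) r7 loop-step n

-- Logarithms and the choice of the alphabet

n<2^n : ∀ n → n < 2 ^ n
n<2^n zero    = s≤s z≤n
n<2^n (suc n) = begin-strict
  suc n            <⟨ s≤s (n<2^n n) ⟩
  suc (2 ^ n)      ≤⟨ +-monoˡ-≤ (2 ^ n) (m^n>0 2 n) ⟩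
  2 ^ n + 2 ^ n    ≡⟨ cong (2 ^ n +_) (+-identityʳ (2 ^ n)) ⟨
  2 ^ suc n        ∎
  where open ≤-Reasoning

n<2^lg : ∀ n → n < 2 ^ lg n
n<2^lg n with n <? 2 ^ lg n
... | yes n< = n<
... | no  n≮ = contradiction
  (subst (_≤ ⌊log₂ n ⌋) (⌊log₂[2^n]⌋≡n (lg n)) (⌊log₂⌋-mono-≤ (≮⇒≥ n≮))) (<-irrefl refl)

2*⌊n/2⌋≤n : ∀ n → 2 * ⌊ n /2⌋ ≤ n
2*⌊n/2⌋≤n zero          = z≤n
2*⌊n/2⌋≤n (suc zero)    = z≤n
2*⌊n/2⌋≤n (suc (suc n)) = ≤-trans (≤-reflexive (*-suc 2 ⌊ n /2⌋)) (s≤s (s≤s (2*⌊n/2⌋≤n n)))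

2^⌊log₂⌋≤ : ∀ n → 1 ≤ n → 2 ^ ⌊log₂ n ⌋ ≤ n
2^⌊log₂⌋≤ = <-rec (λ n → 1 ≤ n → 2 ^ ⌊log₂ n ⌋ ≤ n) go
  where
  go : ∀ n → (∀ {m} → m < n → 1 ≤ m → 2 ^ ⌊log₂ m ⌋ ≤ m) → 1 ≤ n → 2 ^ ⌊log₂ n ⌋ ≤ n
  go (suc zero)      rec _ = s≤s z≤n
  go n@(suc (suc m)) rec _ = begin
    2 ^ ⌊log₂ n ⌋               ≡⟨ cong (2 ^_) (m+[n∸m]≡n log≥1) ⟨
    2 * 2 ^ (⌊log₂ n ⌋ ∸ 1)     ≡⟨ cong (λ l → 2 * 2 ^ l) (⌊log₂⌊n/2⌋⌋≡⌊log₂n⌋∸1 n) ⟨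
    2 * 2 ^ ⌊log₂ ⌊ n /2⌋ ⌋     ≤⟨ *-monoʳ-≤ 2 (rec (⌊n/2⌋<n (suc m)) (s≤s z≤n)) ⟩
    2 * ⌊ n /2⌋                 ≤⟨ 2*⌊n/2⌋≤n n ⟩
    n                           ∎
    where
    open ≤-Reasoning
    log≥1 : 1 ≤ ⌊log₂ n ⌋
    log≥1 = ⌊log₂⌋-mono-≤ {2} {n} (s≤s (s≤s z≤n))

lg-sandwich : ∀ {x} j → 2 ^ j ≤ x → x < 2 ^ suc j → lg x ≡ suc j
lg-sandwich {x} j lo hi = cong suc (≤-antisym
  (≮⇒≥ λ j< → <⇒≱ hi (≤-trans (^-monoʳ-≤ 2 j<) (2^⌊log₂⌋≤ x (≤-trans (m^n>0 2 j) lo))))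
  (subst (_≤ ⌊log₂ x ⌋) (⌊log₂[2^n]⌋≡n j) (⌊log₂⌋-mono-≤ lo)))

^-distribʳ-* : ∀ m n o → (m * n) ^ o ≡ m ^ o * n ^ o
^-distribʳ-* m n zero    = refl
^-distribʳ-* m n (suc o) = trans (cong (m * n *_) (^-distribʳ-* m n o)) ([m*n]*[o*p]≡[m*o]*[n*p] m n (m ^ o) (n ^ o))

-- With q = ⌊l / C⌋ we have 1 + l ≤ C (1 + q) ≤ C 2 ^ q, and C q ≤ l.
polylog≤linear : ∀ C → ∃[ K ] ∀ n → 1 ≤ n → lg n ^ C ≤ K * n
polylog≤linear zero = 1 , λ n 1≤n → ≤-trans 1≤n (≤-reflexive (sym (*-identityˡ n)))
polylog≤linear C@(suc C-1) = C ^ C , λ n 1≤n →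
  let l = ⌊log₂ n ⌋ ; q = l / C in begin
  lg n ^ C               ≤⟨ ^-monoˡ-≤ C (lg≤ l) ⟩
  (C * 2 ^ q) ^ C        ≡⟨ ^-distribʳ-* C (2 ^ q) C ⟩
  C ^ C * (2 ^ q) ^ C    ≡⟨ cong (C ^ C *_) (^-*-assoc 2 q C) ⟩
  C ^ C * 2 ^ (q * C)    ≤⟨ *-monoʳ-≤ (C ^ C) (^-monoʳ-≤ 2 (m/n*n≤m l C)) ⟩
  C ^ C * 2 ^ l          ≤⟨ *-monoʳ-≤ (C ^ C) (2^⌊log₂⌋≤ n 1≤n) ⟩
  C ^ C * n              ∎
  where
  open ≤-Reasoning
  lg≤ : ∀ l → suc l ≤ C * 2 ^ (l / C)
  lg≤ l = begin-strict
    l                          ≡⟨ m≡m%n+[m/n]*n l C ⟩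
    l % C + l / C * C          <⟨ +-monoˡ-< (l / C * C) (m%n<n l C) ⟩
    C + l / C * C              ≡⟨ *-comm (suc (l / C)) C ⟩
    C * suc (l / C)            ≤⟨ *-monoʳ-≤ C (n<2^n (l / C)) ⟩
    C * 2 ^ (l / C)            ∎

-- σ is padded far beyond the letters in use: this makes the alphabet large whatever κ is, and
-- makes the word size of the data structure exactly a constant multiple of lg n.
module WordBounds (n d k P : ℕ) (d≥1 : 1 ≤ d) (n< : n < 2 ^ d) (k≡ : k ≡ P + 6) where

  u σ : ℕ
  u = 2 ^ d
  σ = 2 ^ (k * d ∸ 1)

  k≥1 : 1 ≤ k
  k≥1 = subst (1 ≤_) (sym k≡) (≤-trans (s≤s z≤n) (m≤n+m 6 P))

  kd≥1 : 1 ≤ k * d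
  kd≥1 = *-mono-≤ k≥1 d≥1

  2σ≡ : 2 * σ ≡ 2 ^ (k * d)
  2σ≡ = cong (2 ^_) (m+[n∸m]≡n kd≥1)

  u≥2 : 2 ≤ u
  u≥2 = ^-monoʳ-≤ 2 d≥1

  instance
    u≢0 : NonZero u
    u≢0 = m^n≢0 2 d

  -- Of the exponent `P + 6`, one factor `u` pays for the halving in `σ`, `u ^ 5` outweighs sizes
  -- and lengths of order `u ^ 3`, and `u ^ P` outweighs `P`, which will be the numerator of `κ`.
  σ≥ : u ^ P * u ^ 5 ≤ σ
  σ≥ = *-cancelˡ-≤ 2 (begin
    2 * (u ^ P * u ^ 5)    ≤⟨ *-monoˡ-≤ (u ^ P * u ^ 5) u≥2 ⟩
    u * (u ^ P * u ^ 5)    ≡⟨ e u (u ^ P) (u ^ 5) ⟩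
    u ^ P * u ^ 6          ≡⟨ ^-distribˡ-+-* u P 6 ⟨
    u ^ (P + 6)            ≡⟨ cong (u ^_) k≡ ⟨
    u ^ k                  ≡⟨ ^-*-assoc 2 d k ⟩
    2 ^ (d * k)            ≡⟨ cong (2 ^_) (*-comm d k) ⟩
    2 ^ (k * d)            ≡⟨ 2σ≡ ⟨
    2 * σ                  ∎)
    where
    open ≤-Reasoning
    e : ∀ u x y → u * (x * y) ≡ x * (u * y)
    e = solve-∀

  u⁵≤σ : u ^ 5 ≤ σ
  u⁵≤σ = ≤-trans (≤-trans (≤-reflexive (sym (*-identityˡ (u ^ 5)))) (*-monoˡ-≤ (u ^ 5) (m^n>0 u P))) σ≥

  u≤u⁵ : u ≤ u ^ 5
  u≤u⁵ = ≤-trans (≤-reflexive (sym (^-identityʳ u))) (^-monoʳ-≤ u {1} {5} (s≤s z≤n))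

  n<σ : n < σ
  n<σ = <-≤-trans n< (≤-trans u≤u⁵ u⁵≤σ)

  d< : d < u
  d< = n<2^n d

  4u³≤u⁵ : 4 * u ^ 3 ≤ u ^ 5
  4u³≤u⁵ = ≤-trans (*-monoˡ-≤ (u ^ 3) (*-mono-≤ u≥2 u≥2)) (≤-reflexive (*-assoc u u (u ^ 3)))

  N≤u³ : n * d * suc n ≤ u ^ 3
  N≤u³ = ≤-trans (*-mono-≤ (*-mono-≤ (<⇒≤ n<) (<⇒≤ d<)) n<) (≤-reflexive (e u))
    where
    e : ∀ u → u * u * u ≡ u * (u * (u * 1))
    e = solve-∀

  gN<σ : (n * d ⊔ 1) + suc d * suc n + n * d * suc n < σ
  gN<σ = <-≤-trans (begin-strict
    (n * d ⊔ 1) + suc d * suc n + n * d * suc n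
      ≤⟨ +-mono-≤ (+-mono-≤ (⊔-lub (*-mono-≤ (<⇒≤ n<) (<⇒≤ d<)) (*-mono-≤ 1≤u 1≤u)) (*-mono-≤ d< n<)) N≤u³ ⟩
    u * u + u * u + u ^ 3    ≤⟨ +-monoˡ-≤ (u ^ 3) (≤-trans (≤-reflexive (e₁ (u * u))) (≤-trans (*-monoˡ-≤ (u * u) u≥2) (≤-reflexive (e₂ u)))) ⟩
    u ^ 3 + u ^ 3            <⟨ m<m+n (u ^ 3 + u ^ 3) (≤-trans (m^n>0 u 3) (m≤m+n (u ^ 3) (u ^ 3))) ⟩
    u ^ 3 + u ^ 3 + (u ^ 3 + u ^ 3) ≡⟨ e₃ (u ^ 3) ⟩
    4 * u ^ 3 ∎) (≤-trans 4u³≤u⁵ u⁵≤σ)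
    where
    open ≤-Reasoning
    1≤u : 1 ≤ u
    1≤u = m^n>0 2 d
    e₁ : ∀ x → x + x ≡ 2 * x
    e₁ = solve-∀
    e₂ : ∀ u → u * (u * u) ≡ u * (u * (u * 1))
    e₂ = solve-∀
    e₃ : ∀ x → x + x + (x + x) ≡ 4 * x
    e₃ = solve-∀

  -- Grammar size and text length together stay below the power of two `σ`, so the whole sum lies
  -- between `σ` and `2 σ` and its logarithm is that of `σ`.
  lg≡ : ∀ g → g ≡ (n * d ⊔ 1) + suc d * suc n → lg (g + n * d * suc n + σ) ≡ k * d
  lg≡ g refl = trans (lg-sandwich (k * d ∸ 1) (m≤n+m σ _)
    (<-≤-trans (+-monoˡ-< σ gN<σ) (≤-reflexive (cong (σ +_) (sym (+-identityʳ σ))))))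
    (m+[n∸m]≡n kd≥1)

  2Z<σ : 2 * ((2 + n) * (2 + d)) < σ
  2Z<σ = <-≤-trans (begin-strict
    2 * ((2 + n) * (2 + d))   <⟨ *-monoʳ-< 2 (*-mono-< (lem n<) (lem d<)) ⟩
    2 * (2 * u * (2 * u))     ≡⟨ e u ⟩
    4 * (2 * (u * u))         ≤⟨ *-monoʳ-≤ 4 (*-monoˡ-≤ (u * u) u≥2) ⟩
    4 * (u * (u * u))         ≡⟨ cong (λ x → 4 * (u * (u * x))) (*-identityʳ u) ⟨
    4 * u ^ 3                 ∎) (≤-trans 4u³≤u⁵ u⁵≤σ)
    where
    open ≤-Reasoning
    e : ∀ u → 2 * (2 * u * (2 * u)) ≡ 4 * (2 * (u * u))
    e = solve-∀
    lem : ∀ {x} → x < u → 2 + x < 2 * u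
    lem {x} x<u = ≤-trans (+-mono-≤ u≥2 x<u) (≤-reflexive (cong (u +_) (sym (+-identityʳ u))))

  -- `N` is at most `u ^ 3` and `P` at most `u ^ P`, while `σ ^ 2` is at least `u ^ (2 P + 10)`.
  large : ∀ q l → 1 ≤ q → 1 ≤ l → P ^ 2 * (n * d * suc n) ≤ q ^ 2 * (σ ^ 2 * l)
  large q l q≥1 l≥1 = begin
    P ^ 2 * (n * d * suc n)            ≤⟨ *-mono-≤ (^-monoˡ-≤ 2 P≤) N≤u³ ⟩
    (u ^ P) ^ 2 * u ^ 3                ≤⟨ *-monoʳ-≤ ((u ^ P) ^ 2) (^-monoʳ-≤ u {3} {10} (s≤s (s≤s (s≤s z≤n)))) ⟩
    (u ^ P) ^ 2 * u ^ 10               ≡⟨ cong ((u ^ P) ^ 2 *_) (^-*-assoc u 5 2) ⟨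
    (u ^ P) ^ 2 * (u ^ 5) ^ 2          ≡⟨ ^-distribʳ-* (u ^ P) (u ^ 5) 2 ⟨
    (u ^ P * u ^ 5) ^ 2                ≤⟨ ^-monoˡ-≤ 2 σ≥ ⟩
    σ ^ 2                              ≡⟨ trans (*-identityˡ _) (*-identityʳ _) ⟨
    1 ^ 2 * (σ ^ 2 * 1)                ≤⟨ *-mono-≤ (^-monoˡ-≤ 2 q≥1) (*-monoʳ-≤ (σ ^ 2) l≥1) ⟩
    q ^ 2 * (σ ^ 2 * l)                ∎
    where
    open ≤-Reasoning
    P≤ : P ≤ u ^ P
    P≤ = ≤-trans (<⇒≤ (n<2^n P)) (^-monoˡ-≤ P u≥2)

  module _ (w : ℕ) (kd≤w : k * d ≤ w) where

    2σ≤ : 2 * σ ≤ 2 ^ w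
    2σ≤ = ≤-trans (≤-reflexive 2σ≡) (^-monoʳ-≤ 2 kd≤w)

    σ+σ≤ : σ + σ ≤ 2 ^ w
    σ+σ≤ = ≤-trans (≤-reflexive (cong (σ +_) (sym (+-identityʳ σ)))) 2σ≤

    kd< : k * d < 2 ^ w
    kd< = <-≤-trans (n<2^n (k * d)) (^-monoʳ-≤ 2 kd≤w)

    k< : k < 2 ^ w
    k< = ≤-<-trans (≤-trans (≤-reflexive (sym (*-identityʳ k))) (*-monoʳ-≤ k d≥1)) kd<

    fits : σ + 2 * ((2 + n) * (2 + d)) < 2 ^ w
    fits = <-≤-trans (+-monoʳ-< σ 2Z<σ) σ+σ≤

    σ< : σ < 2 ^ w
    σ< = ≤-<-trans (m≤m+n σ _) fits

    N< : n * d * suc n < 2 ^ w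
    N< = <-trans (≤-<-trans (m≤n+m _ _) gN<σ) σ<

    n+1< : 1 + n < 2 ^ w
    n+1< = ≤-<-trans n<σ σ<

-- Time bounds with rational exponents

-- Soft K m t says t = O(n ^ (2 - 1 / q) log ^ m n), Fast K t says t = O(n ^ (2 - 1 / (2 q))).
module Timing (n q : ℕ) (n≥1 : 1 ≤ n) (q≥1 : 1 ≤ q) where

  Soft : (K m t : ℕ) → Set
  Soft K m t = t ^ q * n ≤ (K * lg n ^ m * n ^ 2) ^ q

  Fast : (K t : ℕ) → Set
  Fast K t = t ^ (q * 2) * n ≤ (K * n ^ 2) ^ (q * 2)

  instance
    n≢0 : NonZero n
    n≢0 = >-nonZero n≥1

  q2≥1 : 1 ≤ q * 2
  q2≥1 = *-mono-≤ q≥1 (s≤s z≤n)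

  self≤power : ∀ x {r} → 1 ≤ r → x ≤ x ^ r
  self≤power zero    _   = z≤n
  self≤power (suc x) r≥1 = ≤-trans (≤-reflexive (sym (^-identityʳ (suc x)))) (^-monoʳ-≤ (suc x) r≥1)

  fast-mono : ∀ {K K′ t t′} → K ≤ K′ → t′ ≤ t → Fast K t → Fast K′ t′
  fast-mono K≤ t≤ f = ≤-trans (*-monoˡ-≤ n (^-monoˡ-≤ (q * 2) t≤))
    (≤-trans f (^-monoˡ-≤ (q * 2) (*-monoˡ-≤ (n ^ 2) K≤)))

  fast-double : ∀ {K t} → Fast K t → Fast (2 * K) (2 * t)
  fast-double {K} {t} f = begin
    (2 * t) ^ (q * 2) * n                      ≡⟨ cong (_* n) (^-distribʳ-* 2 t (q * 2)) ⟩
    2 ^ (q * 2) * t ^ (q * 2) * n              ≡⟨ *-assoc (2 ^ (q * 2)) (t ^ (q * 2)) n ⟩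
    2 ^ (q * 2) * (t ^ (q * 2) * n)            ≤⟨ *-monoʳ-≤ (2 ^ (q * 2)) f ⟩
    2 ^ (q * 2) * (K * n ^ 2) ^ (q * 2)        ≡⟨ ^-distribʳ-* 2 (K * n ^ 2) (q * 2) ⟨
    (2 * (K * n ^ 2)) ^ (q * 2)                ≡⟨ cong (_^ (q * 2)) (*-assoc 2 K (n ^ 2)) ⟨
    (2 * K * n ^ 2) ^ (q * 2)                  ∎
    where open ≤-Reasoning

  -- A sum is at most twice its larger term, which avoids expanding powers of sums.
  fast-+ : ∀ {K K′ t t′} → Fast K t → Fast K′ t′ → Fast (2 * (K ⊔ K′)) (t + t′)
  fast-+ {K} {K′} {t} {t′} f f′ =
    fast-mono {2 * (K ⊔ K′)} {_} {2 * (t ⊔ t′)} {t + t′} ≤-refl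
      (≤-trans (+-mono-≤ (m≤m⊔n t t′) (m≤n⊔m t t′)) (≤-reflexive (cong (t ⊔ t′ +_) (sym (+-identityʳ (t ⊔ t′))))))
      (fast-double {K ⊔ K′} {t ⊔ t′} larger)
    where
    larger : Fast (K ⊔ K′) (t ⊔ t′)
    larger with ⊔-sel t t′
    ... | inj₁ e = subst (Fast (K ⊔ K′)) (sym e) (fast-mono {K} {_} {t} (m≤m⊔n K K′) ≤-refl f)
    ... | inj₂ e = subst (Fast (K ⊔ K′)) (sym e) (fast-mono {K′} {_} {t′} (m≤n⊔m K K′) ≤-refl f′)

  -- Squaring the soft bound gives a second factor n on the left, which absorbs the logarithms.
  soft⇒fast : ∀ {K m t K′} → lg n ^ (m * (q * 2)) ≤ K′ * n → Soft K m t → Fast (K * suc K′) t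
  soft⇒fast {K} {m} {t} {K′} log≤ soft = *-cancelʳ-≤ _ _ n (begin
    t ^ r * n * n                        ≡⟨ cong (λ x → x * n * n) (sym (^-*-assoc t q 2)) ⟩
    (t ^ q) ^ 2 * n * n                  ≡⟨ e₁ (t ^ q) n ⟩
    (t ^ q * n) ^ 2                      ≤⟨ ^-monoˡ-≤ 2 soft ⟩
    ((K * L * n ^ 2) ^ q) ^ 2            ≡⟨ ^-*-assoc (K * L * n ^ 2) q 2 ⟩
    (K * L * n ^ 2) ^ r                  ≡⟨ cong (_^ r) (e₂ K L (n ^ 2)) ⟩
    (K * n ^ 2 * L) ^ r                  ≡⟨ ^-distribʳ-* (K * n ^ 2) L r ⟩
    (K * n ^ 2) ^ r * L ^ r              ≡⟨ cong ((K * n ^ 2) ^ r *_) (^-*-assoc (lg n) m r) ⟩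
    (K * n ^ 2) ^ r * lg n ^ (m * r)     ≤⟨ *-monoʳ-≤ ((K * n ^ 2) ^ r) (≤-trans log≤ (*-monoˡ-≤ n (≤-trans (n≤1+n K′) (self≤power (suc K′) q2≥1)))) ⟩
    (K * n ^ 2) ^ r * (suc K′ ^ r * n)   ≡⟨ *-assoc ((K * n ^ 2) ^ r) (suc K′ ^ r) n ⟨
    (K * n ^ 2) ^ r * suc K′ ^ r * n     ≡⟨ cong (_* n) (^-distribʳ-* (K * n ^ 2) (suc K′) r) ⟨
    (K * n ^ 2 * suc K′) ^ r * n         ≡⟨ cong (λ x → x ^ r * n) (e₂ K (n ^ 2) (suc K′)) ⟩
    (K * suc K′ * n ^ 2) ^ r * n         ∎)
    where
    open ≤-Reasoning
    r = q * 2
    L = lg n ^ m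
    e₁ : ∀ x n → x * (x * 1) * n * n ≡ x * n * (x * n * 1)
    e₁ = solve-∀
    e₂ : ∀ a b c → a * b * c ≡ a * c * b
    e₂ = solve-∀

  -- Of the saving `g^(p/q)` only `n^(1/q)` is kept, so neither `g` nor the numerator of `ε` appears
  -- from here on.
  drop-exponent : ∀ {t g p X} → n ≤ g → 1 ≤ p → t ^ q * g ^ p ≤ X ^ q → t ^ q * n ≤ X ^ q
  drop-exponent {t} {g} {p} n≤g p≥1 h = ≤-trans (*-monoʳ-≤ (t ^ q) (≤-trans n≤g (self≤power g p≥1))) h

  -- The spare factor `n` in `n ^ 2` pays for the factor `n` in `Soft`, because `n ≤ n ^ q`.
  soft-linear : ∀ {K t} → t ≤ K * (n * lg n) → Soft K 1 t
  soft-linear {K} {t} t≤ = begin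
    t ^ q * n                        ≤⟨ *-mono-≤ (^-monoˡ-≤ q t≤) (self≤power n q≥1) ⟩
    (K * (n * lg n)) ^ q * n ^ q     ≡⟨ ^-distribʳ-* (K * (n * lg n)) n q ⟨
    (K * (n * lg n) * n) ^ q         ≡⟨ cong (_^ q) (e K n (lg n)) ⟩
    (K * lg n ^ 1 * n ^ 2) ^ q       ∎
    where
    open ≤-Reasoning
    e : ∀ K n l → K * (n * l) * n ≡ K * (l * 1) * (n * (n * 1))
    e = solve-∀

  -- For the construction: squaring `g = O(n log n)` adds two logarithms to the `c` that come from
  -- `l`.
  soft-quadratic : ∀ {t g p K c l C C′} → n ≤ g → 1 ≤ p → g ≤ C * (n * lg n) → l ≤ C′ * lg n →
                   t ^ q * g ^ p ≤ (K * l ^ c * g ^ 2) ^ q → Soft (K * C′ ^ c * C ^ 2) (c + 2) t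
  soft-quadratic {t} {g} {p} {K} {c} {l} {C} {C′} n≤g p≥1 g≤ l≤ h =
    ≤-trans (drop-exponent {t} {g} {p} n≤g p≥1 h) (^-monoˡ-≤ q (begin
      K * l ^ c * g ^ 2
        ≤⟨ *-mono-≤ (*-monoʳ-≤ K (^-monoˡ-≤ c l≤)) (^-monoˡ-≤ 2 g≤) ⟩
      K * (C′ * lg n) ^ c * (C * (n * lg n)) ^ 2
        ≡⟨ cong (λ x → K * x * (C * (n * lg n)) ^ 2) (^-distribʳ-* C′ (lg n) c) ⟩
      K * (C′ ^ c * lg n ^ c) * (C * (n * lg n)) ^ 2
        ≡⟨ e K (C′ ^ c) (lg n ^ c) C n (lg n) ⟩
      K * C′ ^ c * C ^ 2 * (lg n ^ c * lg n ^ 2) * n ^ 2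
        ≡⟨ cong (λ x → K * C′ ^ c * C ^ 2 * x * n ^ 2) (^-distribˡ-+-* (lg n) c 2) ⟨
      K * C′ ^ c * C ^ 2 * lg n ^ (c + 2) * n ^ 2 ∎))
    where
    open ≤-Reasoning
    e : ∀ K a b C n l → K * (a * b) * (C * (n * l) * (C * (n * l) * 1)) ≡
                        K * a * (C * (C * 1)) * (b * (l * (l * 1))) * (n * (n * 1))
    e = solve-∀

  -- For all queries together: their number `n` raises the exponent from 1 to 2.
  soft-queries : ∀ {t g p K c l C C′} → n ≤ g → 1 ≤ p → g ≤ C * (n * lg n) → l ≤ C′ * lg n →
                 t ^ q * g ^ p ≤ (K * l ^ c * g ^ 1) ^ q → Soft (K * C′ ^ c * C) (c + 1) (n * t)
  soft-queries {t} {g} {p} {K} {c} {l} {C} {C′} n≤g p≥1 g≤ l≤ h = begin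
    (n * t) ^ q * n                          ≡⟨ cong (_* n) (^-distribʳ-* n t q) ⟩
    n ^ q * t ^ q * n                        ≡⟨ *-assoc (n ^ q) (t ^ q) n ⟩
    n ^ q * (t ^ q * n)                      ≤⟨ *-monoʳ-≤ (n ^ q) (drop-exponent {t} {g} {p} n≤g p≥1 h) ⟩
    n ^ q * (K * l ^ c * g ^ 1) ^ q          ≡⟨ ^-distribʳ-* n (K * l ^ c * g ^ 1) q ⟨
    (n * (K * l ^ c * g ^ 1)) ^ q            ≤⟨ ^-monoˡ-≤ q (*-monoʳ-≤ n (*-mono-≤ (*-monoʳ-≤ K (^-monoˡ-≤ c l≤)) (^-monoˡ-≤ 1 g≤))) ⟩
    (n * (K * (C′ * lg n) ^ c * (C * (n * lg n)) ^ 1)) ^ q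
      ≡⟨ cong (λ x → (n * (K * x * (C * (n * lg n)) ^ 1)) ^ q) (^-distribʳ-* C′ (lg n) c) ⟩
    (n * (K * (C′ ^ c * lg n ^ c) * (C * (n * lg n)) ^ 1)) ^ q
      ≡⟨ cong (_^ q) (e K (C′ ^ c) (lg n ^ c) C n (lg n)) ⟩
    (K * C′ ^ c * C * (lg n ^ c * lg n ^ 1) * n ^ 2) ^ q
      ≡⟨ cong (λ x → (K * C′ ^ c * C * x * n ^ 2) ^ q) (^-distribˡ-+-* (lg n) c 1) ⟨
    (K * C′ ^ c * C * lg n ^ (c + 1) * n ^ 2) ^ q ∎
    where
    open ≤-Reasoning
    e : ∀ K a b C n l → n * (K * (a * b) * (C * (n * l) * 1)) ≡
                        K * a * C * (b * (l * 1)) * (n * (n * 1))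
    e = solve-∀

-- The reduction from Orthogonal Vectors

module Reduction (κ ε : ℚᵘ) (p≥1 : 1 ≤ ℤ.∣ ↥ ε ∣) (DS : RangeDistinctDS κ ε) (c : ℕ) (c≥1 : 1 ≤ c) where

  open RangeDistinctDS DS using (build; query; K₁; c₁; K₂; c₂; g₀) renaming (wordMult to wm)

  P k p q B : ℕ
  P = ℤ.∣ ↥ κ ∣
  k = P + 6
  p = ℤ.∣ ↥ ε ∣
  q = ↧ₙ ε
  -- At least 3, because the builder's three inputs occupy shifted registers that must be blank
  -- before the first query.
  B = regBound build ⊔ regBound query ⊔ 3

  build≤B : regBound build ≤ B
  build≤B = ≤-trans (m≤m⊔n _ (regBound query)) (m≤m⊔n _ 3)

  query≤B : regBound query ≤ B
  query≤B = ≤-trans (m≤n⊔m (regBound build) _) (m≤m⊔n _ 3)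

  3≤B : 3 ≤ B
  3≤B = m≤n⊔m (regBound build ⊔ regBound query) 3

  solver : Program
  solver = writeGrammar k ⨾ shift build ⨾ whileNonzero 7 (ask B query) ⨾ op lt 0 13 9

  -- The constants in `g ≤ C n lg n`, in `lg N ≤ C′ lg n`, and in the bound `Cᵣ n lg n` for all work
  -- outside the data structure.
  C C′ Cᵣ : ℕ
  C = c + 1 + 2 * suc c
  C′ = k * c
  Cᵣ = 27 + (suc c * 51 + c * 9) + (2 + (B + 8))

  Kb Kq Kr K : ℕ
  Kb = K₁ * C′ ^ c₁ * C ^ 2 * suc (proj₁ (polylog≤linear ((c₁ + 2) * (q * 2))))
  Kq = K₂ * C′ ^ c₂ * C * suc (proj₁ (polylog≤linear ((c₂ + 1) * (q * 2))))
  Kr = Cᵣ * suc (proj₁ (polylog≤linear (1 * (q * 2))))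
  K = 2 * (Kb ⊔ 2 * (Kq ⊔ Kr))

  QueryTime : ∀ {σ} → SLG σ → (N t : ℕ) → Set
  QueryTime G N t = g₀ ≤ SLG.size G → t ≤[ K₂ * lg N ^ c₂ · SLG.size G ^ 1 - ε ]

  BuildTime : ∀ {σ} → SLG σ → (N t : ℕ) → Set
  BuildTime G N t = g₀ ≤ SLG.size G → t ≤[ K₁ * lg N ^ c₁ · SLG.size G ^ 2 - ε ]

  Answers : ∀ {σ N} → SLG σ → Vec (Fin σ) N → (w : ℕ) → (ℕ → ℕ) → Set
  Answers {σ} {N} G T w M₀ = ∀ {M} → Reachable w query N M₀ M → ∀ b e → b ≤ N → e ≤ N →
    ∃[ t ] ∃[ s ] (w ⊢ query , queryInput w b e M ⇓[ t ] s) × regs s 0 ≡ distinct T b e × QueryTime G N t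

  Built : ∀ {σ N} → SLG σ → Vec (Fin σ) N → (w : ℕ) → Set
  Built {σ} {N} G T w = ∃[ t ] ∃[ s ] (w ⊢ build , SLG.input G w ⇓[ t ] s) × BuildTime G N t × Answers G T w (mem s)

  -- The word size enters through an equation, so that the guarantee can be used at `wm * (k * d)`
  -- once `lg≡` has evaluated the logarithm.
  build-run : ∀ {σ N} (G : SLG σ) (T : Vec (Fin σ) N) → SLG.Represents G T → LargeAlphabet κ σ N →
              ∀ {w} → wm * lg (SLG.size G + N + σ) ≡ w → Built G T w
  build-run G T rep large refl = RangeDistinctDS.correct DS G T rep large

  module Instance (n : ℕ) (A : Vec (BitVec (c * lg n)) n) where

    d : ℕ
    d = c * lg n

    d≥1 : 1 ≤ d
    d≥1 = *-mono-≤ c≥1 (s≤s z≤n)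

    instance
      d≢0 : NonZero d
      d≢0 = >-nonZero d≥1

    n<2^d : n < 2 ^ d
    n<2^d = <-≤-trans (n<2^lg n) (^-monoʳ-≤ 2 (≤-trans (≤-reflexive (sym (*-identityˡ (lg n)))) (*-monoˡ-≤ (lg n) c≥1)))

    open WordBounds n d k P d≥1 n<2^d refl using (σ; n<σ; k≥1; lg≡; large)
    module Bounds = WordBounds n d k P d≥1 n<2^d refl

    g N w : ℕ
    g = (n * d ⊔ 1) + suc d * suc n
    N = n * d * suc n
    w = wm * (k * d)

    kd≤w : k * d ≤ w
    kd≤w = ≤-trans (≤-reflexive (sym (*-identityˡ (k * d)))) (*-monoˡ-≤ (k * d) (>-nonZero⁻¹ wm))

    n+1< : 1 + n < 2 ^ w
    n+1< = Bounds.n+1< w kd≤w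

    1< : 1 < 2 ^ w
    1< = ≤-<-trans (s≤s z≤n) n+1<

    open OVBits w 1< A
    open Encoding n d σ bits bits≤1 bits-end n<σ using (grammar; text; represents; size≡; module Layout)
    open Counting n d σ bits bits≤1 bits-end n<σ using (Meet; stride; distinct-full; distinct-partial)
    open Layout w k k≥1 refl (Bounds.kd< w kd≤w) (Bounds.fits w kd≤w) using (written-is-input)
    open GrammarWriter w n d σ k bits bits≤1 k≥1 refl (Bounds.kd< w kd≤w) (Bounds.fits w kd≤w)

    count : ℕ → ℕ
    count x = distinct text (x * stride) (x * stride + stride)

    N≡ : n * stride ≡ N
    N≡ = e n d
      where
      e : ∀ n d → n * (n * d + d) ≡ n * d * suc n
      e = solve-∀

    Output : State → Set
    Output s = (HasOrthogonalPair A × regs s 0 ≡ 1) ⊎ (¬ HasOrthogonalPair A × regs s 0 ≡ 0)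

    -- A low count names no partner for `x`, so one is searched for; a failed search would make the
    -- count full by `distinct-full`.
    hit⇒pair : ∀ x → distinct text (toℕ x * stride) (toℕ x * stride + stride) ≤ n → HasOrthogonalPair A
    hit⇒pair x hit = decide (any? (λ y → inner (lookup A x) (lookup A y) ≟ 0))
      where
      decide : Dec (∃[ y ] inner (lookup A x) (lookup A y) ≡ 0) → HasOrthogonalPair A
      decide (yes (y , orth)) = lookup A x , lookup A y , Vec.∈-lookup x A , Vec.∈-lookup y A , orth
      decide (no none) = contradiction hit (<⇒≱ (distinct-full x λ y y<n →
        subst (Meet (toℕ x)) (toℕ-fromℕ< y<n)
          (nonorthogonal⇒meet n<σ x (fromℕ< y<n) (λ e → none (fromℕ< y<n , e)))))

    pair⇒hit : HasOrthogonalPair A → ∃[ x ] x < n × count x < 1 + n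
    pair⇒hit (x , y , x∈A , y∈A , orth) =
      toℕ i , toℕ<n i ,
      s≤s (distinct-partial i (toℕ<n j)
        (orthogonal⇒apart n<σ i j (trans (cong₂ inner (sym (lookup-index x∈A)) (sym (lookup-index y∈A))) orth)))
      where
      i = index x∈A
      j = index y∈A

    output : ∀ {s} → regs s 0 ≡ toBit (0 <ᵇ hits (1 + n) count n) → Output s
    output {s} e = decide (0 <? hits (1 + n) count n)
      where
      decide : Dec (0 < hits (1 + n) count n) → Output s
      decide (yes pos) = from-hit (positive⇒hit (1 + n) count n pos)
        where
        from-hit : ∃[ x ] x < n × count x < 1 + n → Output s
        from-hit (x , x<n , hit) = inj₁
          ( hit⇒pair (fromℕ< x<n) (s≤s⁻¹ (subst (λ z → count z < 1 + n) (sym (toℕ-fromℕ< x<n)) hit))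
          , trans e (cong toBit (<⇒<ᵇ-true pos)))
      decide (no ¬pos) = inj₂
        ( (λ pair → let x , x<n , hit = pair⇒hit pair in ¬pos (hit⇒positive (1 + n) count x<n hit))
        , trans e (cong toBit (dec-false (0 <? hits (1 + n) count n) ¬pos)))

    Cost : ℕ → Set
    Cost t = ∃[ tb ] ∃[ tq ] BuildTime grammar N tb × QueryTime grammar N tq ×
      t ≤ tb + (n * tq + (27 + (rowsLength * 17 + n * d * 9) + (2 + n * (B + 8))))

    Solved : Set
    Solved = ∃[ t ] ∃[ s ] (w ⊢ solver , ovInput w A ⇓[ t ] s) × Output s × Cost t

    solved : Solved
    solved = after-writing (writeGrammar-run
        (toWord-small w (<-trans (n<1+n n) n+1<)) (toWord-small w (≤2Z (≤-trans (m≤n+m d 2) d+2≤2Z))) (λ _ → refl) (Bounds.k< w kd≤w))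
      where
      after-writing : ∃[ t ] ∃[ s ] (w ⊢ writeGrammar k , ovInput w A ⇓[ t ] s) × GrammarReady t s → Solved
      after-writing (t₁ , s₁ , run₁ , H , W , t₁≤) = after-build (build-run grammar text represents (large (↧ₙ κ) (lg N) (s≤s z≤n) (s≤s z≤n))
          (cong (wm *_) (lg≡ (SLG.size grammar) size≡)))
        where
        open HandedOver H hiding (stride)
        input∼ : SLG.input grammar w ∼ s₁
        input∼ = agree
          (λ { 0 → trans (toWord-small w (≤2Z d+2≤2Z)) (sym input₀)
             ; 1 → trans (toWord-small w (Bounds.σ< w kd≤w)) (sym input₁)
             ; 2 → trans (cong (λ x → toWord w (suc x)) (+-identityʳ σ))
                     (trans (toWord-small w (≤-<-trans (m≤m+n (suc σ) d) (<-trans (n<1+n _) code<))) (sym input₂))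
             ; (suc (suc (suc r))) → sym (input≥3 r) })
          (written-is-input W)
        after-build : Built grammar text w → Solved
        after-build (tb , sb , runb , tb≤ , answers) = after-simulation (simulate runb input∼)
          where
          after-simulation : ∃[ s₂ ] (w ⊢ shift build , s₁ ⇓[ tb ] s₂) × sb ∼ s₂ × LowRegsKept s₁ s₂ → Solved
          after-simulation (s₂ , run₂ , sb∼s₂ , keep) = after-loop (query-loop start)
            where
            open QueryLoop w B n stride N N≡ query query≤B (≤-trans (n≤1+n 2) 3≤B) (mem sb) count
              (Bounds.N< w kd≤w) n+1< (QueryTime grammar N) (λ _ → z≤n)
              (λ R x x<n → answers R (x * stride) (x * stride + stride)
                 (≤-trans (*-monoˡ-≤ stride (<⇒≤ x<n)) (≤-reflexive N≡))
                 (≤-trans (≤-reflexive (+-comm (x * stride) stride)) (≤-trans (*-monoˡ-≤ stride x<n) (≤-reflexive N≡))))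
            kept : ∀ r {x} → {_ : T (r <ᵇ 16)} → regs s₁ r ≡ x → regs s₂ r ≡ x
            kept r {x} {r<} e = trans (keep r (<ᵇ⇒< r 16 r<)) e
            blank : ∀ r → 3 ≤ r → cells w (2 + d ∷ σ ∷ suc (σ + 0) ∷ []) r ≡ 0
            blank 1 (s≤s ())
            blank 2 (s≤s (s≤s ()))
            blank (suc (suc (suc r))) _ = refl
            start : LoopInv n s₂
            start = inv ≤-refl (kept 2 one) (kept 7 counter)
              (kept 8 (trans position (cong (_* stride) (sym (n∸n≡0 n)))))
              (kept 9 (trans found (cong (hits (1 + n) count) (sym (n∸n≡0 n)))))
              (kept 10 (HandedOver.stride H)) (kept 11 symbols) (kept 13 nil)
              (λ r B≤r → trans (sym (regs∼ sb∼s₂ r)) (trans (untouched runb r (≤-trans build≤B B≤r)) (blank r (≤-trans 3≤B B≤r))))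
              built (mem∼ sb∼s₂)
            after-loop : ∃[ t ] ∃[ s ] (w ⊢ whileNonzero 7 (ask B query) , s₂ ⇓[ t ] s) × LoopInv 0 s ×
                           ∃[ u ] BodyCost u × t ≤ suc (n * suc u) → Solved
            after-loop (t₃ , s₃ , run₃ , I , u , (tq , tq≤ , u≤) , t₃≤) =
              _ , _ , (run₁ ⨾ run₂ ⨾ run₃ ⨾ lt-run 0 (LoopInv.r13 I) (LoopInv.r9 I) 1<) , 
              output {⟨ regs s₃ [ 0 ↦ toBit (0 <ᵇ hits (1 + n) count n) ] , mem s₃ ⟩} refl ,
              (tb , tq , tb≤ , tq≤ , total)
              where
              total : t₁ + (tb + (t₃ + 1)) ≤ tb + (n * tq + (27 + (rowsLength * 17 + n * d * 9) + (2 + n * (B + 8))))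
              total = begin
                t₁ + (tb + (t₃ + 1))
                  ≤⟨ +-mono-≤ t₁≤ (+-monoʳ-≤ tb (+-monoˡ-≤ 1 (≤-trans t₃≤ (s≤s (*-monoʳ-≤ n (s≤s u≤)))))) ⟩
                T₁ + (tb + (suc (n * suc (tq + (B + 7))) + 1))
                  ≡⟨ e T₁ tb n tq B ⟩
                tb + (n * tq + (T₁ + (2 + n * (B + 8)))) ∎
                where
                open ≤-Reasoning
                T₁ = 27 + (rowsLength * 17 + n * d * 9)
                e : ∀ T₁ tb n tq B → T₁ + (tb + (suc (n * suc (tq + (B + 7))) + 1)) ≡
                                     tb + (n * tq + (T₁ + (2 + n * (B + 8))))
                e = solve-∀

    module _ (n≥1 : 1 ≤ n) where

      open Timing n q n≥1 (s≤s z≤n)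

      L nL : ℕ
      L = lg n
      nL = n * L

      1≤nL : 1 ≤ nL
      1≤nL = *-mono-≤ n≥1 (s≤s {0} z≤n)

      const≤ : ∀ x → x ≤ x * nL
      const≤ x = ≤-trans (≤-reflexive (sym (*-identityʳ x))) (*-monoʳ-≤ x 1≤nL)

      nd≡ : n * d ≡ c * nL
      nd≡ = e n c L
        where
        e : ∀ n c l → n * (c * l) ≡ c * (n * l)
        e = solve-∀

      suc-d≤ : suc d ≤ suc c * L
      suc-d≤ = +-monoˡ-≤ (c * L) (s≤s z≤n)

      g≤ : g ≤ C * nL
      g≤ = begin
        (n * d ⊔ 1) + suc d * suc n
          ≤⟨ +-mono-≤ (m⊔n≤m+n (n * d) 1) (*-mono-≤ suc-d≤ (+-monoˡ-≤ n n≥1)) ⟩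
        n * d + 1 + suc c * L * (n + n)
          ≤⟨ +-monoˡ-≤ _ (+-mono-≤ (≤-reflexive nd≡) 1≤nL) ⟩
        c * nL + nL + suc c * L * (n + n)
          ≡⟨ e c n L ⟩
        C * nL ∎
        where
        open ≤-Reasoning
        e : ∀ c n l → c * (n * l) + n * l + suc c * l * (n + n) ≡ (c + 1 + 2 * suc c) * (n * l)
        e = solve-∀

      n≤g : n ≤ g
      n≤g = ≤-trans (n≤1+n n) (≤-trans (m≤m+n (suc n) (d * suc n)) (m≤n+m (suc d * suc n) (n * d ⊔ 1)))

      lgN≤ : lg N ≤ C′ * L
      lgN≤ = begin
        lg N               ≤⟨ s≤s (⌊log₂⌋-mono-≤ (≤-trans (m≤n+m N g) (m≤m+n (g + N) σ))) ⟩
        lg (g + N + σ)     ≡⟨ lg≡ g refl ⟩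
        k * d              ≡⟨ *-assoc k c L ⟨
        k * c * L          ∎
        where open ≤-Reasoning

      remainder≤ : 27 + (rowsLength * 17 + n * d * 9) + (2 + n * (B + 8)) ≤ Cᵣ * nL
      remainder≤ = begin
        27 + (rowsLength * 17 + n * d * 9) + (2 + n * (B + 8))
          ≤⟨ +-mono-≤ (+-mono-≤ (const≤ 27) (+-mono-≤ (*-monoˡ-≤ 17 (*-mono-≤ suc-d≤ (+-monoˡ-≤ n (+-mono-≤ n≥1 n≥1))))
                                                      (*-monoˡ-≤ 9 (≤-reflexive nd≡))))
                      (+-mono-≤ (const≤ 2) (*-monoˡ-≤ (B + 8) n≤nL)) ⟩
        27 * nL + (suc c * L * (n + n + n) * 17 + c * nL * 9) + (2 * nL + nL * (B + 8))
          ≡⟨ e c n L B ⟩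
        Cᵣ * nL ∎
        where
        open ≤-Reasoning
        n≤nL : n ≤ nL
        n≤nL = ≤-trans (≤-reflexive (sym (*-identityʳ n))) (*-monoʳ-≤ n (s≤s z≤n))
        e : ∀ c n l B → 27 * (n * l) + (suc c * l * (n + n + n) * 17 + c * (n * l) * 9) + (2 * (n * l) + n * l * (B + 8)) ≡
                        (27 + (suc c * 51 + c * 9) + (2 + (B + 8))) * (n * l)
        e = solve-∀

      fast-total : g₀ ≤ n → ∀ {t} → Cost t → Fast K t
      fast-total g₀≤n (tb , tq , build-time , query-time , total) =
        fast-mono {K} {K} ≤-refl total
          (fast-+ {Kb} {2 * (Kq ⊔ Kr)} {tb} fast-build (fast-+ {Kq} {Kr} {n * tq} fast-queries fast-rest))
        where
        g₀≤g : g₀ ≤ SLG.size grammar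
        g₀≤g = subst (g₀ ≤_) (sym size≡) (≤-trans g₀≤n n≤g)
        fast-build : Fast Kb tb
        fast-build = soft⇒fast {K₁ * C′ ^ c₁ * C ^ 2} {c₁ + 2} {tb} (proj₂ (polylog≤linear ((c₁ + 2) * (q * 2))) n n≥1)
          (soft-quadratic {tb} {g} {p} {K₁} {c₁} {lg N} {C} {C′} n≤g p≥1 g≤ lgN≤
            (subst (λ g → tb ≤[ K₁ * lg N ^ c₁ · g ^ 2 - ε ]) size≡ (build-time g₀≤g)))
        fast-queries : Fast Kq (n * tq)
        fast-queries = soft⇒fast {K₂ * C′ ^ c₂ * C} {c₂ + 1} {n * tq} (proj₂ (polylog≤linear ((c₂ + 1) * (q * 2))) n n≥1)
          (soft-queries {tq} {g} {p} {K₂} {c₂} {lg N} {C} {C′} n≤g p≥1 g≤ lgN≤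
            (subst (λ g → tq ≤[ K₂ * lg N ^ c₂ · g ^ 1 - ε ]) size≡ (query-time g₀≤g)))
        rest = 27 + (rowsLength * 17 + n * d * 9) + (2 + n * (B + 8))
        fast-rest : Fast Kr rest
        fast-rest = soft⇒fast {Cᵣ} {1} {rest} {proj₁ (polylog≤linear (1 * (q * 2)))} (proj₂ (polylog≤linear (1 * (q * 2))) n n≥1) (soft-linear {Cᵣ} {rest} remainder≤)

  -- This is `1 / (2 q)`: half of the saving `1 / q` has paid for the logarithms. Denominators are
  -- stored minus one, and this form makes `↧ₙ ε′` compute to `q * 2`.
  ε′ : ℚᵘ
  ε′ = mkℚᵘ (ℤ.+ 1) (suc (ℚᵘ.denominator-1 ε * 2))

  algorithm : OVAlgorithm ε′ c
  algorithm = record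
    { program    = solver
    ; wordMult   = wm * (k * c)
    ; wordMult≢0 = >-nonZero (*-mono-≤ (>-nonZero⁻¹ wm) (*-mono-≤ (≤-trans (s≤s z≤n) (m≤n+m 6 P)) c≥1))
    ; K          = K
    -- `n ≥ g₀` puts the grammar size past the data structure's threshold, and `n ≥ 1` lets the
    -- estimates cancel a factor `n`.
    ; n₀         = g₀ ⊔ 1
    ; correct    = λ n A _ → correct n A (Instance.solved n A)
    }
    where
    correct : ∀ n (A : Vec (BitVec (c * lg n)) n) → Instance.Solved n A →
      ∃[ t ] ∃[ s ] (wm * (k * c) * lg n ⊢ solver , ovInput (wm * (k * c) * lg n) A ⇓[ t ] s)
        × ((HasOrthogonalPair A × regs s 0 ≡ 1) ⊎ (¬ HasOrthogonalPair A × regs s 0 ≡ 0))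
        × (g₀ ⊔ 1 ≤ n → t ≤[ K · n ^ 2 - ε′ ])
    correct n A (t , s , run , out , cst) =
      t , s ,
      subst (λ w → w ⊢ solver , ovInput w A ⇓[ t ] s)
        (sym (trans (*-assoc wm (k * c) (lg n)) (cong (wm *_) (*-assoc k c (lg n))))) run ,
      out ,
      λ n₀≤n → subst (λ m → t ^ ↧ₙ ε′ * m ≤ (K * n ^ 2) ^ ↧ₙ ε′) (sym (*-identityʳ n))
        (Instance.fast-total n A (m⊔n≤o⇒n≤o g₀ 1 n₀≤n) (m⊔n≤o⇒m≤o g₀ 1 n₀≤n) cst)

positive⇒numerator≥1 : ∀ ε → Positive ε → 1 ≤ ℤ.∣ ↥ ε ∣
positive⇒numerator≥1 (mkℚᵘ ℤ.+[1+ a ] _) _ = s≤s z≤n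

corollary1p8 : OVConjecture → (κ ε : ℚᵘ) → Positive κ → Positive ε → ¬ RangeDistinctDS κ ε
corollary1p8 ovc κ ε _ ε>0 DS = contradiction-at (ovc ε′ _)
  where
  -- The conjecture reveals `c` only after the exponent is fixed, so `ε′` is computed from `ε` alone
  -- and the reduction accepts every `c ≥ 1`.
  ε′ : ℚᵘ
  ε′ = mkℚᵘ (ℤ.+ 1) (suc (ℚᵘ.denominator-1 ε * 2))
  contradiction-at : ¬ (∃[ c ] 1 ≤ c × ¬ OVAlgorithm ε′ c)
  contradiction-at (c , c≥1 , hard) = hard (Reduction.algorithm κ ε (positive⇒numerator≥1 ε ε>0) DS c c≥1)
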